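{- Let $\mathsf{L}$ be one of the logics $\mathbf{PD}$, $\mathbf{PD}^{\vee}$, $\mathbf{PID}$, and let $\vdash_{\mathsf{L}}$ be derivability in the deduction system for $\mathsf{L}$ given in the context. Then the system is sound and strongly complete: for every set $\Gamma\cup\{\phi\}$ of formulas in the language of $\mathsf{L}$, $$\Gamma\vdash_{\mathsf{L}}\phi\iff\Gamma\models\phi.$$
   Context: **Semantics.** Propositional variables are $p_i$, $i\in\mathbb{N}$. A valuation is a function $s:\mathbb{N}\to\{0,1\}$; a team is a set of valuations. Truth of a formula on a team $X$: - $X\models p_i$ iff $s(i)=1$ for all $s\in X$; $X\models\neg p_i$ iff $s(i)=0$ for all $s\in X$; $X\models\bot$ iff $X=\emptyset$; - $X\models\mathop{=}(p_{i_1},\dots,p_{i_k},p_j)$ ($k\ge0$) iff for all $s,s'\in X$, if $s(i_1)=s'(i_1),\dots,s(i_k)=s'(i_k)$ then $s(j)=s'(j)$; - $X\models\phi\wedge\psi$ iff $X\models\phi$ and $X\models\psi$; - $X\models\phi\otimes\psi$ iff there are $Y,Z\subseteq X$ with $X=Y\cup Z$, $Y\models\phi$, $Z\models\psi$; - $X\models\phi\vee\psi$ iff $X\models\phi$ or $X\models\psi$; - $X\models\phi\to\psi$ iff for all $Y\subseteq X$, $Y\models\phi$ implies $Y\models\psi$. $\Gamma\models\phi$ means: every team on which all formulas of $\Gamma$ are true makes $\phi$ true. **Languages.** $\mathbf{PD}$: atoms $p_i,\neg p_i,\bot,\mathop{=}(p_{i_1},\dots,p_{i_k},p_j)$, connectives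 $\wedge,\otimes$. $\mathbf{PD}^{\vee}$: atoms $p_i,\neg p_i,\bot$, connectives $\wedge,\otimes,\vee$. $\mathbf{PID}$: atoms $p_i,\bot,\mathop{=}(p_{i_1},\dots,p_{i_k},p_j)$, connectives $\wedge,\vee,\to$, with $\neg\phi:=\phi\to\bot$ and $\phi\leftrightarrow\psi:=(\phi\to\psi)\wedge(\psi\to\phi)$. In $\mathbf{PD}$ and $\mathbf{PD}^\vee$ a classical formula is one built from $p_i,\neg p_i,\bot$ using only $\wedge,\otimes$. In all systems, axioms and rules written with $p_i$, $p_j$ or dependence atoms apply to propositional variables only (they are not schemata), while $\phi,\psi,\chi,\theta$ range over arbitrary formulas of the language. There is no substitution rule. $\Gamma\vdash_{\mathsf{L}}\phi$ means there is a derivation of $\phi$ whose (undischarged) hypotheses are in $\Gamma$. **System for $\mathbf{PID}$ (Hilbert style).** Axioms: (1) all substitution instances, in the language of $\mathbf{PID}$, of the axioms of a standard Hilbert system for intuitionistic propositional logic with modus ponens; (2) for all $k$, all instances of $\bigl(\neg\psi\to\bigvee_{1\le i\le k}\neg\chi_i\bigr)\to\bigvee_{1\le i\le k}(\neg\psi\to\neg\chi_i)$, with $\psi,\chi_i$ arbitrary formulas; (3) $\neg\neg p_i\to p_i$; (4) $\mathop{=}(p_i)\leftrightarrow(p_i\vee\neg p_i)$; (5) $\mathop{=}(p_{i_1},\dots,p_{i_k},p_j)\leftrightarrow\bigl((\mathop{=}(p_{i_1})\wedge\dots\wedge\mathop{=}(p_{i_k}))\to\mathop{=}(p_j)\bigr)$.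 Rule: from $\phi\to\psi$ and $\phi$ infer $\psi$. **Natural deduction system for $\mathbf{PD}^{\vee}$.** Axiom: $p_i\otimes\neg p_i$. Rules: - from $\phi$ and $\psi$ infer $\phi\wedge\psi$; from $\phi\wedge\psi$ infer $\phi$, and infer $\psi$; - from $\phi$ infer $\phi\vee\psi$; from $\psi$ infer $\phi\vee\psi$; from $\phi\vee\psi$, a derivation of $\chi$ from $\phi$ and a derivation of $\chi$ from $\psi$, infer $\chi$, discharging these assumptions $\phi$, $\psi$; - from $\phi$ infer $\phi\otimes\psi$; from $\psi$ infer $\phi\otimes\psi$; - (weak elimination) if $\alpha$ is a classical formula: from $\phi\otimes\psi$, a derivation of $\alpha$ from $\phi$ and a derivation of $\alpha$ from $\psi$, infer $\alpha$, discharging $\phi$, $\psi$; - (substitution) from $\phi\otimes\psi$ and a derivation of $\chi$ from $\psi$, infer $\phi\otimes\chi$, discharging $\psi$; - from $\phi\otimes\psi$ infer $\psi\otimes\phi$; from $\phi\otimes(\psi\otimes\chi)$ infer $(\phi\otimes\psi)\otimes\chi$; - from $p_i\wedge\neg p_i$ infer $\bot$; from $\phi\otimes\bot$ infer $\phi$; - (distributivity) from $\phi\otimes(\psi\vee\chi)$ infer $(\phi\otimes\psi)\vee(\phi\otimes\chi)$. The sub-derivations in discharging rules may use further undischarged hypotheses. **Natural deduction system for $\mathbf{PD}$.** The axiom $p_i\otimes\neg p_i$ and all the rules of the system for $\mathbf{PD}^{\vee}$ that do not mention $\vee$ (applied to formulas of $\mathbf{PD}$), together with: - from $p_i$ infer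 $\mathop{=}(p_i)$; from $\neg p_i$ infer $\mathop{=}(p_i)$; - from a derivation of $\mathop{=}(p_j)$ from assumptions $\mathop{=}(p_{i_1}),\dots,\mathop{=}(p_{i_k})$, infer $\mathop{=}(p_{i_1},\dots,p_{i_k},p_j)$, discharging these assumptions; - from $\mathop{=}(p_i)$, a derivation of $\theta$ from $p_i$ and a derivation of $\theta$ from $\neg p_i$, infer $\theta$, discharging $p_i$, $\neg p_i$; - from $\mathop{=}(p_{i_1},\dots,p_{i_k},p_j)$, $\mathop{=}(p_{i_1}),\dots,\mathop{=}(p_{i_k})$ infer $\mathop{=}(p_j)$; - (strong elimination) given a particular occurrence of an atom $\mathop{=}(p_i)$ in $\phi$, let $\phi^{1}$ and $\phi^0$ be the results of replacing that occurrence in $\phi$ by $p_i$ and by $\neg p_i$ respectively: from $\phi$, a derivation of $\theta$ from $\phi^1$ and a derivation of $\theta$ from $\phi^0$, infer $\theta$, discharging $\phi^1$, $\phi^0$. -}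

module Defs where

import Data.Empty as Empty
open import Data.Bool.Base using (Bool; true; false)
open import Data.List.Base using (List; []; _∷_; map)
import Data.List.Membership.Propositional as List
open import Data.List.NonEmpty as List⁺ using (List⁺; _∷_)
open import Data.List.Relation.Unary.All using (All)
open import Data.Nat.Base using (ℕ)
open import Data.Product.Base using (_×_; ∃₂)
open import Data.Sum.Base using (_⊎_)
open import Data.Unit.Base using (⊤)
open import Level using (Level; 0ℓ; Lift)
open import Relation.Binary.PropositionalEquality using (_≡_)
open import Relation.Unary using (Pred; _∈_; _⊆_; _∪_; _≐_; ｛_｝; Empty)

infixr 8 _∧_
infixr 7 _⊗_ _∨_
infixr 6 _⇒_
infix  5 _⇔̇_
infix  3 _⊨_ _⊩_ _⊢ᴺ_ _⊢ᴴ_ _⊢_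

1ℓ : Level
1ℓ = Level.suc 0ℓ

data Logic : Set where
  PD PD∨ PID : Logic

-- HasTensor also governs the negated variables: both belong to exactly PD, PD∨.

HasTensor : Logic → Set
HasTensor PD  = ⊤
HasTensor PD∨ = ⊤
HasTensor PID = Empty.⊥

HasDep : Logic → Set
HasDep PD  = ⊤
HasDep PD∨ = Empty.⊥
HasDep PID = ⊤

HasOr : Logic → Set
HasOr PD  = Empty.⊥
HasOr PD∨ = ⊤
HasOr PID = ⊤

HasImp : Logic → Set
HasImp PD  = Empty.⊥
HasImp PD∨ = Empty.⊥
HasImp PID = ⊤

data Formula (L : Logic) : Set where
  p   : ℕ → Formula L
  ⊥   : Formula L
  ¬p  : .⦃ HasTensor L ⦄ → ℕ → Formula L
  -- dep (i₁ ∷ … ∷ iₖ ∷ []) j  is  =(p_{i₁}, …, p_{iₖ}, p_j).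
  dep : .⦃ HasDep L ⦄ → List ℕ → ℕ → Formula L
  _∧_ : Formula L → Formula L → Formula L
  _⊗_ : .⦃ HasTensor L ⦄ → Formula L → Formula L → Formula L
  _∨_ : .⦃ HasOr L ⦄ → Formula L → Formula L → Formula L
  _⇒_ : .⦃ HasImp L ⦄ → Formula L → Formula L → Formula L

-- con i  is  =(p_i).
pattern con i = dep [] i

¬_ : Formula PID → Formula PID
¬ φ = φ ⇒ ⊥

_⇔̇_ : Formula PID → Formula PID → Formula PID
φ ⇔̇ ψ = (φ ⇒ ψ) ∧ (ψ ⇒ φ)

Theory : Logic → Set₁
Theory L = Pred (Formula L) 0ℓ

Valuation : Set
Valuation = ℕ → Bool

Team : Set₁
Team = Pred Valuation 0ℓ

_⊨_ : ∀ {L} → Team → Formula L → Set₁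
X ⊨ p i      = Lift 1ℓ (∀ {s} → s ∈ X → s i ≡ true)
X ⊨ ⊥        = Lift 1ℓ (Empty X)
X ⊨ ¬p i     = Lift 1ℓ (∀ {s} → s ∈ X → s i ≡ false)
X ⊨ dep is j = Lift 1ℓ (∀ {s s′} → s ∈ X → s′ ∈ X →
                        All (λ i → s i ≡ s′ i) is → s j ≡ s′ j)
X ⊨ φ ∧ ψ    = X ⊨ φ × X ⊨ ψ
X ⊨ φ ⊗ ψ    = ∃₂ λ (Y Z : Team) → X ≐ Y ∪ Z × Y ⊨ φ × Z ⊨ ψ
X ⊨ φ ∨ ψ    = X ⊨ φ ⊎ X ⊨ ψ
X ⊨ φ ⇒ ψ    = ∀ (Y : Team) → Y ⊆ X → Y ⊨ φ → Y ⊨ ψ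

_⊩_ : ∀ {L} → Theory L → Formula L → Set₁
Γ ⊩ φ = ∀ (X : Team) → (∀ {ψ} → ψ ∈ Γ → X ⊨ ψ) → X ⊨ φ

data Classical {L} .⦃ _ : HasTensor L ⦄ : Formula L → Set where
  p   : ∀ i → Classical (p i)
  ¬p  : ∀ i → Classical (¬p i)
  ⊥   : Classical ⊥
  _∧_ : ∀ {α β} → Classical α → Classical β → Classical (α ∧ β)
  _⊗_ : ∀ {α β} → Classical α → Classical β → Classical (α ⊗ β)

data Occurrence {L} .⦃ _ : HasTensor L ⦄ .⦃ _ : HasDep L ⦄ (i : ℕ) :
                Formula L → Set where
  here : Occurrence i (con i)
  ∧ˡ   : ∀ {φ ψ} → Occurrence i φ → Occurrence i (φ ∧ ψ)
  ∧ʳ   : ∀ {φ ψ} → Occurrence i ψ → Occurrence i (φ ∧ ψ)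
  ⊗ˡ   : ∀ {φ ψ} → Occurrence i φ → Occurrence i (φ ⊗ ψ)
  ⊗ʳ   : ∀ {φ ψ} → Occurrence i ψ → Occurrence i (φ ⊗ ψ)

replace : ∀ {L} .⦃ _ : HasTensor L ⦄ .⦃ _ : HasDep L ⦄ {i} {φ : Formula L} →
          Occurrence i φ → Formula L → Formula L
replace             here   χ       = χ
replace (∧ˡ {ψ = ψ} o)     χ = replace o χ ∧ ψ
replace (∧ʳ {φ = φ} o)     χ = φ ∧ replace o χ
replace (⊗ˡ {ψ = ψ} o)     χ = replace o χ ⊗ ψ
replace (⊗ʳ {φ = φ} o)     χ = φ ⊗ replace o χ

-- Natural deduction for PD and PD∨.  Γ ⊢ᴺ φ is the type of derivations of φ
-- whose undischarged hypotheses lie in Γ; a discharging rule extends Γ in its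
-- subderivations.  The rules mentioning ∨ are available only in PD∨ and those
-- mentioning dependence atoms only in PD; all the others are shared.

data _⊢ᴺ_ {L} .⦃ _ : HasTensor L ⦄ (Γ : Theory L) : Formula L → Set where
  hyp   : ∀ {φ} → φ ∈ Γ → Γ ⊢ᴺ φ
  em    : ∀ i → Γ ⊢ᴺ p i ⊗ ¬p i

  ∧I    : ∀ {φ ψ} → Γ ⊢ᴺ φ → Γ ⊢ᴺ ψ → Γ ⊢ᴺ φ ∧ ψ
  ∧E₁   : ∀ {φ ψ} → Γ ⊢ᴺ φ ∧ ψ → Γ ⊢ᴺ φ
  ∧E₂   : ∀ {φ ψ} → Γ ⊢ᴺ φ ∧ ψ → Γ ⊢ᴺ ψ

  ⊗I₁   : ∀ {φ ψ} → Γ ⊢ᴺ φ → Γ ⊢ᴺ φ ⊗ ψ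
  ⊗I₂   : ∀ {φ ψ} → Γ ⊢ᴺ ψ → Γ ⊢ᴺ φ ⊗ ψ
  ⊗E    : ∀ {φ ψ α} → Classical α → Γ ⊢ᴺ φ ⊗ ψ →
          (Γ ∪ ｛ φ ｝) ⊢ᴺ α → (Γ ∪ ｛ ψ ｝) ⊢ᴺ α → Γ ⊢ᴺ α
  ⊗sub  : ∀ {φ ψ χ} → Γ ⊢ᴺ φ ⊗ ψ → (Γ ∪ ｛ ψ ｝) ⊢ᴺ χ → Γ ⊢ᴺ φ ⊗ χ
  ⊗comm : ∀ {φ ψ} → Γ ⊢ᴺ φ ⊗ ψ → Γ ⊢ᴺ ψ ⊗ φ
  ⊗ass  : ∀ {φ ψ χ} → Γ ⊢ᴺ φ ⊗ (ψ ⊗ χ) → Γ ⊢ᴺ (φ ⊗ ψ) ⊗ χ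

  ⊥I    : ∀ {i} → Γ ⊢ᴺ p i ∧ ¬p i → Γ ⊢ᴺ ⊥
  ⊥E    : ∀ {φ} → Γ ⊢ᴺ φ ⊗ ⊥ → Γ ⊢ᴺ φ

  ∨I₁   : .⦃ _ : HasOr L ⦄ → ∀ {φ ψ} → Γ ⊢ᴺ φ → Γ ⊢ᴺ φ ∨ ψ
  ∨I₂   : .⦃ _ : HasOr L ⦄ → ∀ {φ ψ} → Γ ⊢ᴺ ψ → Γ ⊢ᴺ φ ∨ ψ
  ∨E    : .⦃ _ : HasOr L ⦄ → ∀ {φ ψ χ} → Γ ⊢ᴺ φ ∨ ψ →
          (Γ ∪ ｛ φ ｝) ⊢ᴺ χ → (Γ ∪ ｛ ψ ｝) ⊢ᴺ χ → Γ ⊢ᴺ χ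
  distr : .⦃ _ : HasOr L ⦄ → ∀ {φ ψ χ} →
          Γ ⊢ᴺ φ ⊗ (ψ ∨ χ) → Γ ⊢ᴺ (φ ⊗ ψ) ∨ (φ ⊗ χ)

  conI₁ : .⦃ _ : HasDep L ⦄ → ∀ {i} → Γ ⊢ᴺ p i → Γ ⊢ᴺ con i
  conI₀ : .⦃ _ : HasDep L ⦄ → ∀ {i} → Γ ⊢ᴺ ¬p i → Γ ⊢ᴺ con i
  conE  : .⦃ _ : HasDep L ⦄ → ∀ {i θ} → Γ ⊢ᴺ con i →
          (Γ ∪ ｛ p i ｝) ⊢ᴺ θ → (Γ ∪ ｛ ¬p i ｝) ⊢ᴺ θ → Γ ⊢ᴺ θ
  depI  : .⦃ _ : HasDep L ⦄ → ∀ {is j} →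
          (Γ ∪ (List._∈ map (λ i → con i) is)) ⊢ᴺ con j → Γ ⊢ᴺ dep is j
  depE  : .⦃ _ : HasDep L ⦄ → ∀ {is j} → Γ ⊢ᴺ dep is j →
          (∀ {i} → i List.∈ is → Γ ⊢ᴺ con i) → Γ ⊢ᴺ con j
  strE  : .⦃ _ : HasDep L ⦄ → ∀ {i φ θ} (o : Occurrence i φ) → Γ ⊢ᴺ φ →
          (Γ ∪ ｛ replace o (p i) ｝) ⊢ᴺ θ →
          (Γ ∪ ｛ replace o (¬p i) ｝) ⊢ᴺ θ → Γ ⊢ᴺ θ

-- Iterated connectives associate to the right.  They are taken over nonempty
-- lists, since the language has no empty conjunction and the disjunction
-- axiom below is unsound for an empty disjunction read as ⊥.

⋀ ⋁ : List⁺ (Formula PID) → Formula PID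
⋀ = List⁺.foldr₁ _∧_
⋁ = List⁺.foldr₁ _∨_

data Axiom : Formula PID → Set where
  K    : ∀ φ ψ → Axiom (φ ⇒ (ψ ⇒ φ))
  S    : ∀ φ ψ χ → Axiom ((φ ⇒ (ψ ⇒ χ)) ⇒ ((φ ⇒ ψ) ⇒ (φ ⇒ χ)))
  ∧I   : ∀ φ ψ → Axiom (φ ⇒ (ψ ⇒ (φ ∧ ψ)))
  ∧E₁  : ∀ φ ψ → Axiom ((φ ∧ ψ) ⇒ φ)
  ∧E₂  : ∀ φ ψ → Axiom ((φ ∧ ψ) ⇒ ψ)
  ∨I₁  : ∀ φ ψ → Axiom (φ ⇒ (φ ∨ ψ))
  ∨I₂  : ∀ φ ψ → Axiom (ψ ⇒ (φ ∨ ψ))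
  ∨E   : ∀ φ ψ χ → Axiom ((φ ⇒ χ) ⇒ ((ψ ⇒ χ) ⇒ ((φ ∨ ψ) ⇒ χ)))
  ⊥E   : ∀ φ → Axiom (⊥ ⇒ φ)
  disj : ∀ ψ χs → Axiom ((¬ ψ ⇒ ⋁ (List⁺.map ¬_ χs)) ⇒
                         ⋁ (List⁺.map (λ χ → ¬ ψ ⇒ ¬ χ) χs))
  dne  : ∀ i → Axiom (¬ (¬ p i) ⇒ p i)
  conA : ∀ i → Axiom (con i ⇔̇ (p i ∨ ¬ p i))
  depA : ∀ i is j → Axiom (dep (i ∷ is) j ⇔̇
                           (⋀ (List⁺.map (λ i → con i) (i ∷ is)) ⇒ con j))

data _⊢ᴴ_ (Γ : Theory PID) : Formula PID → Set where
  hyp : ∀ {φ} → φ ∈ Γ → Γ ⊢ᴴ φ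
  ax  : ∀ {φ} → Axiom φ → Γ ⊢ᴴ φ
  mp  : ∀ {φ ψ} → Γ ⊢ᴴ φ ⇒ ψ → Γ ⊢ᴴ φ → Γ ⊢ᴴ ψ

_⊢_ : ∀ {L} → Theory L → Formula L → Set
_⊢_ {PD}  = _⊢ᴺ_
_⊢_ {PD∨} = _⊢ᴺ_
_⊢_ {PID} = _⊢ᴴ_

{-# OPTIONS --safe #-}

-- Every formula is equivalent, derivably and on all teams, to the disjunction of
-- finitely many flat formulas (true on a team as soon as they are true at each of
-- its members): classical formulas for PD and PD∨, negations for PID.  In PD the
-- disjunction is not expressible, and the derivable half of the equivalence says
-- that θ follows from φ once it follows from each part; strong elimination gives
-- this for a constancy atom inside any context of ∧ and ⊗, as distributivity does
-- in PD∨ for ∨.  If Γ does not derive φ, take Δ ⊇ Γ maximal among the theories not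
-- deriving φ: it contains a part of each of its members, so the team X of all
-- valuations satisfying the flat members of Δ makes Γ true.  Were φ true on X, some
-- part of φ would be, and strong completeness for flat formulas would derive it,
-- hence φ, from Δ.

module Submission where

open import Defs
open import Axiom.ExcludedMiddle using (ExcludedMiddle)
open import Data.Bool.Base using (true; false)
open import Data.Bool.Properties using (¬-not)
open import Data.Empty as Empty using (⊥-elim; ⊥-elim-irr)
open import Data.List.Base using (List; []; _∷_; _++_; cartesianProductWith)
import Data.List.Base as List
open import Data.List.Membership.Propositional using () renaming (_∈_ to _∈ᴸ_)
open import Data.List.Membership.Propositional.Properties
  using (∈-++⁺ˡ; ∈-++⁺ʳ; ∈-++⁻; ∈-map⁺; ∈-map⁻;
         ∈-cartesianProductWith⁺; ∈-cartesianProductWith⁻)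
open import Data.List.NonEmpty as List⁺ using (List⁺; _∷_)
open import Data.List.Relation.Unary.All as All using (All; []; _∷_)
open import Data.List.Relation.Unary.Any using (here; there)
open import Data.Nat.Base using (ℕ; zero; suc; _+_; _≤_; s≤s; _≤′_; ≤′-refl; ≤′-step; _⊔_)
open import Data.Nat.Properties
  using (≤-refl; ≤-trans; ≤⇒≤′; m≤m⊔n; m≤n⊔m; +-suc; +-identityʳ; suc-injective)
open import Data.Product.Base using (_×_; _,_; proj₁; proj₂; ∃; ∃₂)
open import Data.Sum.Base as Sum using (_⊎_; inj₁; inj₂; [_,_])
open import Data.Unit.Base using (⊤; tt)
open import Function.Base using (id; _∘_; _∋_; it)
open import Function.Bundles using (_⇔_; mk⇔)
open import Level using (Lift; lift; lower)
open import Relation.Binary.PropositionalEquality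
  using (_≡_; refl; sym; trans; cong; subst)
open import Relation.Nullary using (Dec; does; yes; no) renaming (¬_ to Not)
open import Relation.Unary using (_∈_; _⊆_; _∪_; _∩_; ｛_｝; Empty; ∅)

private variable
  L : Logic
  A : Set
  X Y Z : Team
  s : Valuation
  i j : ℕ
  is : List ℕ

-- Team semantics

true≢false : Not (true ≡ false)
true≢false ()

-- Dismisses the implication case when recursing on formulas of `PD` and `PD∨`.
tensor-no-imp : ∀ L → .(HasTensor L) → .(HasImp L) → Empty.⊥
tensor-no-imp PD  _ ()
tensor-no-imp PD∨ _ ()
tensor-no-imp PID () _

downward : ∀ (φ : Formula L) → Y ⊆ X → X ⊨ φ → Y ⊨ φ
downward (p i)      Y⊆X (lift f) = lift (f ∘ Y⊆X)
downward ⊥          Y⊆X (lift f) = lift λ s → f s ∘ Y⊆X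
downward (¬p i)     Y⊆X (lift f) = lift (f ∘ Y⊆X)
downward (dep is j) Y⊆X (lift f) = lift λ s∈Y s′∈Y → f (Y⊆X s∈Y) (Y⊆X s′∈Y)
downward (φ ∧ ψ)    Y⊆X (x , y)  = downward φ Y⊆X x , downward ψ Y⊆X y
downward {Y = Y} (φ ⊗ ψ) Y⊆X (A , B , (X⊆ , _) , a , b) =
  Y ∩ A , Y ∩ B ,
  ((λ s∈Y → Sum.map (s∈Y ,_) (s∈Y ,_) (X⊆ (Y⊆X s∈Y))) , [ proj₁ , proj₁ ]) ,
  downward φ proj₂ a , downward ψ proj₂ b
downward (φ ∨ ψ)    Y⊆X = Sum.map (downward φ Y⊆X) (downward ψ Y⊆X)
downward (φ ⇒ ψ)    Y⊆X f Z Z⊆Y = f Z (Y⊆X ∘ Z⊆Y)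

empty-⊨ : ∀ (φ : Formula L) → Empty X → X ⊨ φ
empty-⊨ (p i)      X∅ = lift λ s∈X → ⊥-elim (X∅ _ s∈X)
empty-⊨ ⊥          X∅ = lift X∅
empty-⊨ (¬p i)     X∅ = lift λ s∈X → ⊥-elim (X∅ _ s∈X)
empty-⊨ (dep is j) X∅ = lift λ s∈X → ⊥-elim (X∅ _ s∈X)
empty-⊨ (φ ∧ ψ)    X∅ = empty-⊨ φ X∅ , empty-⊨ ψ X∅
empty-⊨ {X = X} (φ ⊗ ψ) X∅ =
  X , X , (inj₁ , [ id , id ]) , empty-⊨ φ X∅ , empty-⊨ ψ X∅
empty-⊨ (φ ∨ ψ)    X∅ = inj₁ (empty-⊨ φ X∅)
empty-⊨ (φ ⇒ ψ)    X∅ Y Y⊆X _ = empty-⊨ ψ λ s → X∅ s ∘ Y⊆X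

-- A cover suffices in place of an exact splitting: intersecting both halves with `X` is harmless by
-- downward closure.
⊗-⊨ : ∀ .⦃ _ : HasTensor L ⦄ (φ ψ : Formula L) →
      X ⊆ Y ∪ Z → Y ⊨ φ → Z ⊨ ψ → X ⊨ φ ⊗ ψ
⊗-⊨ {X = X} {Y} {Z} φ ψ X⊆ y z =
  X ∩ Y , X ∩ Z ,
  ((λ s∈X → Sum.map (s∈X ,_) (s∈X ,_) (X⊆ s∈X)) , [ proj₁ , proj₁ ]) ,
  downward φ proj₂ y , downward ψ proj₂ z

-- Truth on a singleton team, as a predicate small enough to define teams with.
Holds : Valuation → Formula L → Set
Holds s (p i)      = s i ≡ true
Holds s ⊥          = Empty.⊥
Holds s (¬p i)     = s i ≡ false
Holds s (dep is j) = ⊤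
Holds s (φ ∧ ψ)    = Holds s φ × Holds s ψ
Holds s (φ ⊗ ψ)    = Holds s φ ⊎ Holds s ψ
Holds s (φ ∨ ψ)    = Holds s φ ⊎ Holds s ψ
Holds s (φ ⇒ ψ)    = Holds s φ → Holds s ψ

-- At a tensor, the team splits into the valuations satisfying the left formula and those satisfying
-- the right one.
classical-⊨ : .⦃ _ : HasTensor L ⦄ {α : Formula L} → Classical α →
              (∀ {s} → s ∈ X → Holds s α) → X ⊨ α
classical-⊨ (p i)   f = lift f
classical-⊨ (¬p i)  f = lift f
classical-⊨ ⊥       f = lift λ s → f
classical-⊨ (c ∧ d) f = classical-⊨ c (proj₁ ∘ f) , classical-⊨ d (proj₂ ∘ f)
classical-⊨ {X = X} (_⊗_ {α} {β} c d) f =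
  ⊗-⊨ {Y = λ s → X s × Holds s α} {Z = λ s → X s × Holds s β} α β
    (λ s∈X → Sum.map (s∈X ,_) (s∈X ,_) (f s∈X))
    (classical-⊨ c proj₂) (classical-⊨ d proj₂)

data Negated : Formula PID → Set where
  neg : ∀ χ → Negated (¬ χ)

module Semantics (lem : ExcludedMiddle 1ℓ) where

  dec : (P : Set) → Dec P
  dec P with lem {Lift 1ℓ P}
  ... | yes (lift x) = yes x
  ... | no  ¬x       = no (¬x ∘ lift)

  by-contradiction : {P : Set} → (Not P → Empty.⊥) → P
  by-contradiction {P} f with dec P
  ... | yes x = x
  ... | no ¬x = ⊥-elim (f ¬x)

  singleton⁻ : ∀ (φ : Formula L) → ｛ s ｝ ⊨ φ → Holds s φ
  singleton⁺ : ∀ (φ : Formula L) → Holds s φ → ｛ s ｝ ⊨ φ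

  singleton⁻ (p i)      (lift f) = f refl
  singleton⁻ ⊥          (lift f) = f _ refl
  singleton⁻ (¬p i)     (lift f) = f refl
  singleton⁻ (dep is j) _        = tt
  singleton⁻ (φ ∧ ψ)    (x , y)  = singleton⁻ φ x , singleton⁻ ψ y
  singleton⁻ (φ ⊗ ψ) (A , B , (s⊆ , _) , a , b) =
    Sum.map (λ s∈A → singleton⁻ φ (downward φ (λ { refl → s∈A }) a))
            (λ s∈B → singleton⁻ ψ (downward ψ (λ { refl → s∈B }) b)) (s⊆ refl)
  singleton⁻ (φ ∨ ψ)    = Sum.map (singleton⁻ φ) (singleton⁻ ψ)
  singleton⁻ (φ ⇒ ψ) f x = singleton⁻ ψ (f _ id (singleton⁺ φ x))

  singleton⁺ (p i)      x = lift λ { refl → x }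
  singleton⁺ (¬p i)     x = lift λ { refl → x }
  singleton⁺ (dep is j) _ = lift λ { refl refl _ → refl }
  singleton⁺ (φ ∧ ψ) (x , y) = singleton⁺ φ x , singleton⁺ ψ y
  singleton⁺ (φ ⊗ ψ) (inj₁ x) =
    ⊗-⊨ {Z = ∅} φ ψ inj₁ (singleton⁺ φ x) (empty-⊨ ψ λ _ ())
  singleton⁺ (φ ⊗ ψ) (inj₂ y) =
    ⊗-⊨ {Y = ∅} φ ψ inj₂ (empty-⊨ φ λ _ ()) (singleton⁺ ψ y)
  singleton⁺ (φ ∨ ψ) = Sum.map (singleton⁺ φ) (singleton⁺ ψ)
  -- A subteam of a singleton is the whole singleton or empty, and the empty team satisfies every
  -- formula.
  singleton⁺ {s = s} (φ ⇒ ψ) f Y Y⊆s y with dec (s ∈ Y)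
  ... | yes s∈Y = downward ψ Y⊆s
                    (singleton⁺ ψ (f (singleton⁻ φ (downward φ (λ { refl → s∈Y }) y))))
  ... | no  s∉Y = empty-⊨ ψ λ t t∈Y → s∉Y (subst Y (sym (Y⊆s t∈Y)) t∈Y)

  pointwise : ∀ (φ : Formula L) → X ⊨ φ → s ∈ X → Holds s φ
  pointwise φ x s∈X = singleton⁻ φ (downward φ (λ { refl → s∈X }) x)

  -- Negations are flat whatever `χ` is: by downward closure, a member of a subteam satisfying `χ`
  -- would satisfy `χ` by itself.
  negation-⊨ : ∀ χ → (∀ {s} → s ∈ X → Holds s (¬ χ)) → X ⊨ ¬ χ
  negation-⊨ χ f Y Y⊆X y = lift λ s s∈Y → f (Y⊆X s∈Y) (pointwise χ y s∈Y)

  con-⊨⁻ : .⦃ _ : HasDep L ⦄ → X ⊨ (Formula L ∋ con i) →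
           (∀ {s} → s ∈ X → s i ≡ true) ⊎ (∀ {s} → s ∈ X → s i ≡ false)
  con-⊨⁻ {X = X} {i = i} (lift f) with dec (∃ λ s → s ∈ X × s i ≡ true)
  ... | yes (s , s∈X , si) = inj₁ λ t∈X → trans (f t∈X s∈X []) si
  ... | no  none           = inj₂ λ t∈X → ¬-not λ ti → none (_ , t∈X , ti)

  -- Soundness of natural deduction

  module _ {L : Logic} .⦃ _ : HasTensor L ⦄ where

    -- The occurrence is evaluated on a single subteam, where the variable is constant; the
    -- surrounding splittings can be kept unchanged.
    replace-⊨ : .⦃ _ : HasDep L ⦄ {φ : Formula L} (o : Occurrence i φ) → X ⊨ φ →
                X ⊨ replace o (p i) ⊎ X ⊨ replace o (¬p i)
    replace-⊨ here   x        = Sum.map lift lift (con-⊨⁻ {L} x)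
    replace-⊨ (∧ˡ o) (x , y) = Sum.map (_, y) (_, y) (replace-⊨ o x)
    replace-⊨ (∧ʳ o) (x , y) = Sum.map (x ,_) (x ,_) (replace-⊨ o y)
    replace-⊨ (⊗ˡ o) (A , B , eq , a , b) =
      Sum.map (λ a′ → A , B , eq , a′ , b) (λ a′ → A , B , eq , a′ , b) (replace-⊨ o a)
    replace-⊨ (⊗ʳ o) (A , B , eq , a , b) =
      Sum.map (λ b′ → A , B , eq , a , b′) (λ b′ → A , B , eq , a , b′) (replace-⊨ o b)

    private variable
      Γ : Theory L
      φ : Formula L

    _⊨*_ : Team → Theory L → Set₁
    X ⊨* Γ = ∀ {ψ} → ψ ∈ Γ → X ⊨ ψ

    downward* : Y ⊆ X → X ⊨* Γ → Y ⊨* Γ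
    downward* Y⊆X x {ψ} ψ∈Γ = downward ψ Y⊆X (x ψ∈Γ)

    _,*_ : X ⊨* Γ → X ⊨ φ → X ⊨* (Γ ∪ ｛ φ ｝)
    (x ,* y) (inj₁ ψ∈Γ) = x ψ∈Γ
    (x ,* y) (inj₂ refl) = y

    soundᴺ : Γ ⊢ᴺ φ → ∀ X → X ⊨* Γ → X ⊨ φ
    soundᴺ (hyp φ∈Γ)    X x = x φ∈Γ
    soundᴺ (em i) X x =
      ⊗-⊨ {L = L} {Y = λ s → s i ≡ true} {Z = λ s → s i ≡ false} (p i) (¬p i)
        (λ {s} _ → split (s i)) (lift id) (lift id)
      where
      split : ∀ b → b ≡ true ⊎ b ≡ false
      split true  = inj₁ refl
      split false = inj₂ refl
    soundᴺ (∧I d e)     X x = soundᴺ d X x , soundᴺ e X x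
    soundᴺ (∧E₁ d)      X x = proj₁ (soundᴺ d X x)
    soundᴺ (∧E₂ d)      X x = proj₂ (soundᴺ d X x)
    soundᴺ (⊗I₁ {φ} {ψ} d) X x =
      ⊗-⊨ {Z = ∅} φ ψ inj₁ (soundᴺ d X x) (empty-⊨ ψ λ _ ())
    soundᴺ (⊗I₂ {φ} {ψ} d) X x =
      ⊗-⊨ {Y = ∅} φ ψ inj₂ (empty-⊨ φ λ _ ()) (soundᴺ d X x)
    -- Truth on both halves gives truth at every member of `X`; flatness of `α` is what lifts this
    -- back to `X`.
    soundᴺ (⊗E {α = α} c d e f) X x with soundᴺ d X x
    ... | A , B , (X⊆ , ⊆X) , a , b = classical-⊨ c λ s∈X →
      [ pointwise α (soundᴺ e A (downward* (⊆X ∘ inj₁) x ,* a))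
      , pointwise α (soundᴺ f B (downward* (⊆X ∘ inj₂) x ,* b)) ] (X⊆ s∈X)
    soundᴺ (⊗sub d e) X x with soundᴺ d X x
    ... | A , B , eq , a , b =
      A , B , eq , a , soundᴺ e B (downward* (proj₂ eq ∘ inj₂) x ,* b)
    soundᴺ (⊗comm d) X x with soundᴺ d X x
    ... | A , B , (X⊆ , ⊆X) , a , b =
      B , A , (Sum.swap ∘ X⊆ , ⊆X ∘ Sum.swap) , b , a
    soundᴺ (⊗ass d) X x with soundᴺ d X x
    ... | A , B , (X⊆ , ⊆X) , a , C , D , (B⊆ , ⊆B) , c , d′ =
      A ∪ C , D ,
      ( Sum.assocˡ ∘ Sum.map₂ B⊆ ∘ X⊆ , ⊆X ∘ Sum.map₂ ⊆B ∘ Sum.assocʳ ) ,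
      (A , C , (id , id) , a , c) , d′
    soundᴺ (⊥I d) X x with soundᴺ d X x
    ... | lift f , lift g = lift λ s s∈X → true≢false (trans (sym (f s∈X)) (g s∈X))
    soundᴺ (⊥E {φ} d) X x with soundᴺ d X x
    ... | A , B , (X⊆ , _) , a , lift B∅ =
      downward φ ([ id , ⊥-elim ∘ B∅ _ ] ∘ X⊆) a
    soundᴺ (∨I₁ d) X x = inj₁ (soundᴺ d X x)
    soundᴺ (∨I₂ d) X x = inj₂ (soundᴺ d X x)
    soundᴺ (∨E d e f) X x =
      [ (λ y → soundᴺ e X (x ,* y)) , (λ y → soundᴺ f X (x ,* y)) ] (soundᴺ d X x)
    soundᴺ (distr d) X x with soundᴺ d X x
    ... | A , B , eq , a , b =
      Sum.map (λ b′ → A , B , eq , a , b′) (λ b′ → A , B , eq , a , b′) b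
    soundᴺ (conI₁ d) X x with soundᴺ d X x
    ... | lift f = lift λ s∈X s′∈X _ → trans (f s∈X) (sym (f s′∈X))
    soundᴺ (conI₀ d) X x with soundᴺ d X x
    ... | lift f = lift λ s∈X s′∈X _ → trans (f s∈X) (sym (f s′∈X))
    soundᴺ (conE d e f) X x =
      [ (λ y → soundᴺ e X (x ,* lift y)) , (λ y → soundᴺ f X (x ,* lift y)) ]
        (con-⊨⁻ {L} (soundᴺ d X x))
    -- Dependence is a condition on pairs. On the team of `s` and `s′` alone, agreement on `is` is
    -- exactly constancy of each variable of `is`, so the premise applies there.
    soundᴺ {Γ = Γ} (depI {is} d) X x = lift λ {s} {s′} s∈X s′∈X eqs →
      lower (soundᴺ d (｛ s ｝ ∪ ｛ s′ ｝)
        (λ { (inj₁ ψ∈Γ) → downward* (λ { (inj₁ refl) → s∈X ; (inj₂ refl) → s′∈X }) x ψ∈Γ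
           ; (inj₂ ψ∈is) → con-pair eqs ψ∈is }))
        (inj₁ refl) (inj₂ refl) []
      where
      con-pair : ∀ {s s′} {ψ : Formula L} → All (λ i → s i ≡ s′ i) is →
                 ψ ∈ᴸ List.map (λ i → con i) is → (｛ s ｝ ∪ ｛ s′ ｝) ⊨ ψ
      con-pair eqs ψ∈is with ∈-map⁻ _ ψ∈is
      ... | i , i∈is , refl = lift λ
        { (inj₁ refl) (inj₁ refl) _ → refl
        ; (inj₁ refl) (inj₂ refl) _ → All.lookup eqs i∈is
        ; (inj₂ refl) (inj₁ refl) _ → sym (All.lookup eqs i∈is)
        ; (inj₂ refl) (inj₂ refl) _ → refl }
    soundᴺ (depE d e) X x = lift λ s∈X s′∈X _ →
      lower (soundᴺ d X x) s∈X s′∈X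
        (All.tabulate λ i∈is → lower (soundᴺ (e i∈is) X x) s∈X s′∈X [])
    soundᴺ (strE o d e f) X x =
      [ (λ y → soundᴺ e X (x ,* y)) , (λ y → soundᴺ f X (x ,* y)) ]
        (replace-⊨ o (soundᴺ d X x))

  -- Soundness of the Hilbert calculus

  ⋁-⊨-map : ∀ {f g : Formula PID → Formula PID} χ χs →
            (∀ χ → Y ⊨ f χ → X ⊨ g χ) →
            Y ⊨ ⋁ (List⁺.map f (χ ∷ χs)) → X ⊨ ⋁ (List⁺.map g (χ ∷ χs))
  ⋁-⊨-map χ []        h y = h χ y
  ⋁-⊨-map χ (χ′ ∷ χs) h = Sum.map (h χ) (⋁-⊨-map χ′ χs h)

  ⋀-⊨⁻ : ∀ i is → Y ⊨ ⋀ (List⁺.map (λ i → con i) (i ∷ is)) →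
         All (λ i → Y ⊨ (Formula PID ∋ con i)) (i ∷ is)
  ⋀-⊨⁻ i []        y       = y ∷ []
  ⋀-⊨⁻ i (i′ ∷ is) (y , z) = y ∷ ⋀-⊨⁻ i′ is z

  ⋀-⊨⁺ : ∀ i is → All (λ i → Y ⊨ (Formula PID ∋ con i)) (i ∷ is) →
         Y ⊨ ⋀ (List⁺.map (λ i → con i) (i ∷ is))
  ⋀-⊨⁺ i []        (y ∷ []) = y
  ⋀-⊨⁺ i (i′ ∷ is) (y ∷ ys) = y , ⋀-⊨⁺ i′ is ys

  axiom-sound : ∀ {φ} → Axiom φ → X ⊨ φ
  axiom-sound (K φ ψ)   Y _ y Z Z⊆Y _ = downward φ Z⊆Y y
  axiom-sound (S φ ψ χ) A _ a B B⊆A b C C⊆B c = a C (B⊆A ∘ C⊆B) c C id (b C C⊆B c)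
  axiom-sound (∧I φ ψ)  Y _ y Z Z⊆Y z = downward φ Z⊆Y y , z
  axiom-sound (∧E₁ φ ψ) Y _ = proj₁
  axiom-sound (∧E₂ φ ψ) Y _ = proj₂
  axiom-sound (∨I₁ φ ψ) Y _ = inj₁
  axiom-sound (∨I₂ φ ψ) Y _ = inj₂
  axiom-sound (∨E φ ψ χ) A _ a B B⊆A b C C⊆B = [ a C (B⊆A ∘ C⊆B) , b C C⊆B ]
  axiom-sound (⊥E φ)    Y _ (lift Y∅) = empty-⊨ φ Y∅
  -- Since `¬ ψ` is flat, `Y` has a largest subteam satisfying it. The disjunct true on that one is
  -- inherited by every other subteam satisfying `¬ ψ`, so a single choice serves all of them.
  axiom-sound (disj ψ (χ ∷ χs)) Y _ y =
    ⋁-⊨-map χ χs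
      (λ χ z W W⊆Y w → downward (¬ χ) (λ s∈W → W⊆Y s∈W , pointwise (¬ ψ) w s∈W) z)
      (y (λ s → Y s × Holds s (¬ ψ)) proj₁ (negation-⊨ ψ proj₂))
  axiom-sound (dne i)   Y _ y = lift λ {s} s∈Y →
    by-contradiction (pointwise (¬ (¬ p i)) y s∈Y)
  axiom-sound (conA i) =
    (λ Y _ y → Sum.map lift
       (λ f → negation-⊨ (p i) λ s∈Y si → true≢false (trans (sym si) (f s∈Y)))
       (con-⊨⁻ {PID} y)) ,
    (λ { Y _ (inj₁ (lift f)) → lift λ s∈Y s′∈Y _ → trans (f s∈Y) (sym (f s′∈Y))
       ; Y _ (inj₂ f) → lift λ s∈Y s′∈Y _ →
           trans (¬-not (pointwise (¬ p i) f s∈Y))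
                 (sym (¬-not (pointwise (¬ p i) f s′∈Y))) })
  axiom-sound (depA i is j) =
    (λ Y _ (lift f) Z Z⊆Y z → lift λ s∈Z s′∈Z _ → f (Z⊆Y s∈Z) (Z⊆Y s′∈Z)
       (All.map (λ (lift c) → c s∈Z s′∈Z []) (⋀-⊨⁻ i is z))) ,
    (λ Y _ f → lift λ {s} {s′} s∈Y s′∈Y eqs →
       lower (f (｛ s ｝ ∪ ｛ s′ ｝) (λ { (inj₁ refl) → s∈Y ; (inj₂ refl) → s′∈Y })
               (⋀-⊨⁺ i is (All.map (λ eq → lift λ
                 { (inj₁ refl) (inj₁ refl) _ → refl
                 ; (inj₁ refl) (inj₂ refl) _ → eq
                 ; (inj₂ refl) (inj₁ refl) _ → sym eq
                 ; (inj₂ refl) (inj₂ refl) _ → refl }) eqs)))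
         (inj₁ refl) (inj₂ refl) [])

  soundᴴ : ∀ {Γ φ} → Γ ⊢ᴴ φ → ∀ X → (∀ {ψ} → ψ ∈ Γ → X ⊨ ψ) → X ⊨ φ
  soundᴴ (hyp φ∈Γ) X x = x φ∈Γ
  soundᴴ (ax a)    X x = axiom-sound a
  soundᴴ (mp d e)  X x = soundᴴ d X x X id (soundᴴ e X x)

-- Compactness

-- Holding from some stage on, rather than at some stage, lets the bounds for several premises be
-- merged by a maximum.
Eventually : (ℕ → Set) → Set
Eventually P = ∃ λ n → ∀ m → n ≤ m → P m

ev-map : ∀ {P Q : ℕ → Set} → (∀ n → P n → Q n) → Eventually P → Eventually Q
ev-map f (n , x) = n , λ m n≤m → f m (x m n≤m)

ev-map₂ : ∀ {P Q R : ℕ → Set} → (∀ n → P n → Q n → R n) →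
          Eventually P → Eventually Q → Eventually R
ev-map₂ f (k , x) (l , y) = k ⊔ l , λ m k⊔l≤m →
  f m (x m (≤-trans (m≤m⊔n k l) k⊔l≤m)) (y m (≤-trans (m≤n⊔m k l) k⊔l≤m))

ev-map₃ : ∀ {P Q R S : ℕ → Set} → (∀ n → P n → Q n → R n → S n) →
          Eventually P → Eventually Q → Eventually R → Eventually S
ev-map₃ f x y z = ev-map₂ (λ n g → g) (ev-map₂ f x y) z

ev-All : ∀ {P : ℕ → A → Set} xs → (∀ {x} → x ∈ᴸ xs → Eventually (λ n → P n x)) →
         Eventually (λ n → ∀ x → x ∈ᴸ xs → P n x)
ev-All []       f = 0 , λ _ _ _ ()
ev-All (x ∷ xs) f = ev-map₂
  (λ { _ px _ _ (here refl) → px ; _ _ pxs _ (there x∈xs) → pxs _ x∈xs })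
  (f (here refl)) (ev-All xs (f ∘ there))

-- Covers both compactness (D a chain with union Γ) and weakening (D constant).
record _⟶_ {L} (Γ : Theory L) (D : ℕ → Theory L) : Set where
  constructor incl
  field at : ∀ {φ} → φ ∈ Γ → Eventually (λ n → φ ∈ D n)
open _⟶_

ext : ∀ {Γ : Theory L} {D} Θ → Γ ⟶ D → (Γ ∪ Θ) ⟶ (λ n → D n ∪ Θ)
ext Θ w .at (inj₁ φ∈Γ) = ev-map (λ _ → inj₁) (w .at φ∈Γ)
ext Θ w .at (inj₂ φ∈Θ) = 0 , λ _ _ → inj₂ φ∈Θ

-- A derivation uses finitely many hypotheses. Discharged assumptions are added on both sides by
-- `ext`; the premises of `depE`, indexed by a list, are brought to a common stage by `ev-All`.
limᴺ : .⦃ _ : HasTensor L ⦄ → ∀ {Γ : Theory L} {D φ} →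
       Γ ⟶ D → Γ ⊢ᴺ φ → Eventually (λ n → D n ⊢ᴺ φ)
limᴺ w (hyp φ∈Γ)    = ev-map (λ _ → hyp) (w .at φ∈Γ)
limᴺ w (em i)       = 0 , λ _ _ → em i
limᴺ w (∧I d e)     = ev-map₂ (λ _ → ∧I) (limᴺ w d) (limᴺ w e)
limᴺ w (∧E₁ d)      = ev-map (λ _ → ∧E₁) (limᴺ w d)
limᴺ w (∧E₂ d)      = ev-map (λ _ → ∧E₂) (limᴺ w d)
limᴺ w (⊗I₁ d)      = ev-map (λ _ → ⊗I₁) (limᴺ w d)
limᴺ w (⊗I₂ d)      = ev-map (λ _ → ⊗I₂) (limᴺ w d)
limᴺ w (⊗E c d e f) = ev-map₃ (λ _ → ⊗E c) (limᴺ w d) (limᴺ (ext _ w) e) (limᴺ (ext _ w) f)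
limᴺ w (⊗sub d e)   = ev-map₂ (λ _ → ⊗sub) (limᴺ w d) (limᴺ (ext _ w) e)
limᴺ w (⊗comm d)    = ev-map (λ _ → ⊗comm) (limᴺ w d)
limᴺ w (⊗ass d)     = ev-map (λ _ → ⊗ass) (limᴺ w d)
limᴺ w (⊥I d)       = ev-map (λ _ → ⊥I) (limᴺ w d)
limᴺ w (⊥E d)       = ev-map (λ _ → ⊥E) (limᴺ w d)
limᴺ w (∨I₁ d)      = ev-map (λ _ → ∨I₁) (limᴺ w d)
limᴺ w (∨I₂ d)      = ev-map (λ _ → ∨I₂) (limᴺ w d)
limᴺ w (∨E d e f)   = ev-map₃ (λ _ → ∨E) (limᴺ w d) (limᴺ (ext _ w) e) (limᴺ (ext _ w) f)
limᴺ w (distr d)    = ev-map (λ _ → distr) (limᴺ w d)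
limᴺ w (conI₁ d)    = ev-map (λ _ → conI₁) (limᴺ w d)
limᴺ w (conI₀ d)    = ev-map (λ _ → conI₀) (limᴺ w d)
limᴺ w (conE d e f) = ev-map₃ (λ _ → conE) (limᴺ w d) (limᴺ (ext _ w) e) (limᴺ (ext _ w) f)
limᴺ w (depI d)     = ev-map (λ _ → depI) (limᴺ (ext _ w) d)
limᴺ w (depE {is} d e) =
  ev-map₂ (λ _ x y → depE x (y _)) (limᴺ w d) (ev-All is λ i∈is → limᴺ w (e i∈is))
limᴺ w (strE o d e f) =
  ev-map₃ (λ _ → strE o) (limᴺ w d) (limᴺ (ext _ w) e) (limᴺ (ext _ w) f)

limᴴ : ∀ {Γ D φ} → Γ ⟶ D → Γ ⊢ᴴ φ → Eventually (λ n → D n ⊢ᴴ φ)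
limᴴ w (hyp φ∈Γ) = ev-map (λ _ → hyp) (w .at φ∈Γ)
limᴴ w (ax a)    = 0 , λ _ _ → ax a
limᴴ w (mp d e)  = ev-map₂ (λ _ → mp) (limᴴ w d) (limᴴ w e)

constant : ∀ {Γ Δ : Theory L} → Γ ⊆ Δ → Γ ⟶ (λ _ → Δ)
constant Γ⊆Δ = incl λ φ∈Γ → 0 , λ _ _ → Γ⊆Δ φ∈Γ

-- Enumeration of formulas

next : ℕ × ℕ → ℕ × ℕ
next (zero  , b) = suc b , 0
next (suc a , b) = a , suc b

unpair : ℕ → ℕ × ℕ
unpair zero    = 0 , 0
unpair (suc n) = next (unpair n)

-- `next` walks down each antidiagonal and then jumps to the start of the following one. `go` traces
-- the walk backwards, by induction on the antidiagonal and then on the position along it.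
unpair-surjective : ∀ a b → ∃ λ n → unpair n ≡ (a , b)
unpair-surjective a b = go (a + b) b a refl
  where
  go : ∀ k b a → a + b ≡ k → ∃ λ n → unpair n ≡ (a , b)
  go k (suc b) a eq with go k b (suc a) (trans (sym (+-suc a b)) eq)
  ... | n , eq′ = suc n , cong next eq′
  go k zero zero eq = 0 , refl
  go (suc k) zero (suc a) eq
    with go k a 0 (suc-injective (trans (cong suc (sym (+-identityʳ a))) eq))
  ... | n , eq′ = suc n , cong next eq′

-- Decodes constructors that only some of the languages have; the default is used when the
-- constructor is absent.
optional : ∀ {P : Set} → Dec P → (.P → A) → A → A
optional (yes x) f a = f x
optional (no _)  f a = a

optional-yes : ∀ {P : Set} (d : Dec P) {f : .P → A} {a} .(x : P) → optional d f a ≡ f x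
optional-yes (yes _) x = refl
optional-yes (no ¬x) x = ⊥-elim-irr (¬x x)

tensor? : ∀ L → Dec (HasTensor L)
tensor? PD  = yes tt
tensor? PD∨ = yes tt
tensor? PID = no id

dep? : ∀ L → Dec (HasDep L)
dep? PD  = yes tt
dep? PD∨ = no id
dep? PID = yes tt

or? : ∀ L → Dec (HasOr L)
or? PD  = no id
or? PD∨ = yes tt
or? PID = yes tt

imp? : ∀ L → Dec (HasImp L)
imp? PD  = no id
imp? PD∨ = no id
imp? PID = yes tt

decodeList : ℕ → ℕ → List ℕ
decodeList zero    _ = []
decodeList (suc d) n with unpair n
... | i , m = i ∷ decodeList d m

-- decode d inverts an encoding of the formulas of depth at most d; the codes
-- pack a tag with two arguments.
decode : ℕ → ℕ → Formula L
build : ℕ → ℕ → ℕ × ℕ → Formula L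

decode zero    _ = ⊥
decode (suc d) n with unpair n
... | t , m = build d t (unpair m)

build d 0 (i , _) = p i
build d 1 _       = ⊥
build {L} d 2 (i , _) = optional (tensor? L) (λ h → ¬p ⦃ h ⦄ i) ⊥
build {L} d 3 (n , j) with unpair n
... | l , m = optional (dep? L) (λ h → dep ⦃ h ⦄ (decodeList l m) j) ⊥
build {L} d 4 (m , n) = decode d m ∧ decode d n
build {L} d 5 (m , n) = optional (tensor? L) (λ h → _⊗_ ⦃ h ⦄ (decode d m) (decode d n)) ⊥
build {L} d 6 (m , n) = optional (or? L) (λ h → _∨_ ⦃ h ⦄ (decode d m) (decode d n)) ⊥
build {L} d _ (m , n) = optional (imp? L) (λ h → _⇒_ ⦃ h ⦄ (decode d m) (decode d n)) ⊥

decodeList-surjective : ∀ is → ∃ λ n → decodeList (List.length is) n ≡ is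
decodeList-surjective []       = 0 , refl
decodeList-surjective (i ∷ is) with decodeList-surjective is
... | m , eq with unpair-surjective i m
... | n , eq′ = n , lemma
  where
  lemma : decodeList (suc (List.length is)) n ≡ i ∷ is
  lemma rewrite eq′ = cong (i ∷_) eq

depth : Formula L → ℕ
depth (p i)      = 0
depth ⊥          = 0
depth (¬p i)     = 0
depth (dep is j) = 0
depth (φ ∧ ψ)    = suc (depth φ ⊔ depth ψ)
depth (φ ⊗ ψ)    = suc (depth φ ⊔ depth ψ)
depth (φ ∨ ψ)    = suc (depth φ ⊔ depth ψ)
depth (φ ⇒ ψ)    = suc (depth φ ⊔ depth ψ)

tagged : ∀ d t m n {φ : Formula L} → build d t (m , n) ≡ φ → ∃ λ k → decode (suc d) k ≡ φ
tagged d t m n {φ} eq with unpair-surjective m n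
... | x , eqx with unpair-surjective t x
... | k , eqk = k , lemma
  where
  lemma : decode (suc d) k ≡ φ
  lemma rewrite eqk | eqx = eq

-- The `suc` is there because `decode zero` yields only `⊥`, so even an atom costs one unit of fuel.
decode-surjective : ∀ (φ : Formula L) d → depth φ ≤ d → ∃ λ n → decode (suc d) n ≡ φ
decode-surjective (p i) d _ = tagged d 0 i 0 refl
decode-surjective ⊥     d _ = tagged d 1 0 0 refl
decode-surjective {L} (¬p ⦃ h ⦄ i) d _ = tagged d 2 i 0 (optional-yes (tensor? L) h)
decode-surjective {L} (dep ⦃ h ⦄ is j) d _ with decodeList-surjective is
... | m , eq with unpair-surjective (List.length is) m
... | n , eq′ = tagged d 3 n j lemma
  where
  lemma : build d 3 (n , j) ≡ dep ⦃ h ⦄ is j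
  lemma rewrite eq′ | eq = optional-yes (dep? L) h
decode-surjective (φ ∧ ψ) (suc d) (s≤s le)
  with decode-surjective φ d (≤-trans (m≤m⊔n _ _) le)
     | decode-surjective ψ d (≤-trans (m≤n⊔m _ _) le)
... | m , refl | n , refl = tagged (suc d) 4 m n refl
decode-surjective {L} (_⊗_ ⦃ h ⦄ φ ψ) (suc d) (s≤s le)
  with decode-surjective φ d (≤-trans (m≤m⊔n _ _) le)
     | decode-surjective ψ d (≤-trans (m≤n⊔m _ _) le)
... | m , refl | n , refl = tagged (suc d) 5 m n (optional-yes (tensor? L) h)
decode-surjective {L} (_∨_ ⦃ h ⦄ φ ψ) (suc d) (s≤s le)
  with decode-surjective φ d (≤-trans (m≤m⊔n _ _) le)
     | decode-surjective ψ d (≤-trans (m≤n⊔m _ _) le)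
... | m , refl | n , refl = tagged (suc d) 6 m n (optional-yes (or? L) h)
decode-surjective {L} (_⇒_ ⦃ h ⦄ φ ψ) (suc d) (s≤s le)
  with decode-surjective φ d (≤-trans (m≤m⊔n _ _) le)
     | decode-surjective ψ d (≤-trans (m≤n⊔m _ _) le)
... | m , refl | n , refl = tagged (suc d) 7 m n (optional-yes (imp? L) h)

enumerate : ℕ → Formula L
enumerate n with unpair n
... | d , m = decode d m

enumerate-surjective : ∀ (φ : Formula L) → ∃ λ n → enumerate n ≡ φ
enumerate-surjective φ with decode-surjective φ (depth φ) ≤-refl
... | m , eq with unpair-surjective (suc (depth φ)) m
... | n , eq′ = n , lemma
  where
  lemma : enumerate n ≡ φ
  lemma rewrite eq′ = eq

-- Lindenbaum extensions and completeness

module Calculus {L} (_⊢ˢ_ : Theory L → Formula L → Set)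
  (lim : ∀ {Γ D φ} → Γ ⟶ D → Γ ⊢ˢ φ → Eventually (λ n → D n ⊢ˢ φ)) where

  private variable
    Γ Δ : Theory L
    φ ψ θ α : Formula L

  weaken : Γ ⊆ Δ → Γ ⊢ˢ φ → Δ ⊢ˢ φ
  weaken Γ⊆Δ d with lim (constant Γ⊆Δ) d
  ... | n , e = e n ≤-refl

  wk : Γ ⊢ˢ φ → (Γ ∪ Δ) ⊢ˢ φ
  wk = weaken inj₁

  wk₂ : (Γ ∪ ｛ φ ｝) ⊢ˢ θ → ((Γ ∪ Δ) ∪ ｛ φ ｝) ⊢ˢ θ
  wk₂ = weaken (Sum.map₁ inj₁)

  -- Avoiding a fixed `θ` replaces consistency, which would be too weak: a theory that fails to
  -- derive `θ` need not be consistent with any formula refuting it, for instance when `θ` is a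
  -- constancy atom.
  record MaximalAvoiding (θ : Formula L) (Δ : Theory L) : Set where
    field
      avoids  : Not (Δ ⊢ˢ θ)
      maximal : ∀ {φ} → Not ((Δ ∪ ｛ φ ｝) ⊢ˢ θ) → φ ∈ Δ

  module _ (Γ : Theory L) (θ : Formula L) where

    -- The test for adding a formula is stored as a proposition inside membership, so the
    -- construction decides nothing.
    stage : ℕ → Theory L
    stage zero    = Γ
    stage (suc n) = λ φ → φ ∈ stage n ⊎ φ ≡ enumerate n × Not ((stage n ∪ ｛ φ ｝) ⊢ˢ θ)

    stage-mono : ∀ {m n} → m ≤′ n → stage m ⊆ stage n
    stage-mono ≤′-refl       = id
    stage-mono (≤′-step m≤n) = inj₁ ∘ stage-mono m≤n

    -- A derivation of `θ` at the next stage shows that the new formula fails its test; then nothing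
    -- was added, and the derivation lives at the previous stage.
    stage-avoids : Not (Γ ⊢ˢ θ) → ∀ n → Not (stage n ⊢ˢ θ)
    stage-avoids ¬d zero    = ¬d
    stage-avoids ¬d (suc n) d =
      new (weaken (λ { (inj₁ x) → inj₁ x ; (inj₂ (refl , _)) → inj₂ refl }) d)
      where
      new : Not ((stage n ∪ ｛ enumerate n ｝) ⊢ˢ θ)
      new e = stage-avoids ¬d n
        (weaken (λ { (inj₁ x) → x ; (inj₂ (refl , ¬e)) → ⊥-elim (¬e e) }) d)

    limit : Theory L
    limit φ = ∃ λ n → φ ∈ stage n

    lindenbaum : Not (Γ ⊢ˢ θ) → ∃ λ Δ → Γ ⊆ Δ × MaximalAvoiding θ Δ
    lindenbaum ¬d = limit , (0 ,_) , record { avoids = avoids ; maximal = maximal }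
      where
      avoids : Not (limit ⊢ˢ θ)
      avoids d with lim (incl λ (n , x) → n , λ m n≤m → stage-mono (≤⇒≤′ n≤m) x) d
      ... | n , e = stage-avoids ¬d n (e n ≤-refl)

      maximal : ∀ {φ} → Not ((limit ∪ ｛ φ ｝) ⊢ˢ θ) → φ ∈ limit
      maximal {φ} ¬d with enumerate-surjective φ
      ... | n , refl = suc n , inj₂ (refl , λ d → ¬d (weaken (Sum.map₁ (n ,_)) d))

  -- The parts of φ are formulas whose disjunction is equivalent to φ, both
  -- derivably and on every team.
  record Resolution (Flat : Formula L → Set) (φ : Formula L) : Set₁ where
    field
      parts : List (Formula L)
      flat  : α ∈ᴸ parts → Flat α
      intro : α ∈ᴸ parts → Γ ⊢ˢ α → Γ ⊢ˢ φ
      elim  : Γ ⊢ˢ φ → (∀ {α} → α ∈ᴸ parts → (Γ ∪ ｛ α ｝) ⊢ˢ θ) → Γ ⊢ˢ θ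
      cover : X ⊨ φ → ∃ λ α → α ∈ᴸ parts × X ⊨ α

  module Completeness (lem : ExcludedMiddle 1ℓ)
    (hyp   : ∀ {Γ φ} → φ ∈ Γ → Γ ⊢ˢ φ)
    (sound : ∀ {Γ φ} → Γ ⊢ˢ φ → Γ ⊩ φ)
    (Flat  : Formula L → Set)
    (flat-⊨ : ∀ {α X} → Flat α → (∀ {s} → s ∈ X → Holds s α) → X ⊨ α)
    (flat-complete : ∀ {Δ β} → Flat β →
      (∀ s → (∀ {α} → Flat α → α ∈ Δ → Holds s α) → Holds s β) → Δ ⊢ˢ β)
    (resolve : ∀ φ → Resolution Flat φ) where

    open Semantics lem
    open Resolution

    module _ (max : MaximalAvoiding θ Δ) where
      open MaximalAvoiding max

      canonicalTeam : Team
      canonicalTeam s = ∀ {α} → Flat α → α ∈ Δ → Holds s α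

      -- If `Δ` contained no part, maximality would derive `θ` from each of them, and `elim` would
      -- derive it from `Δ`.
      part∈ : ψ ∈ Δ → ∃ λ α → α ∈ᴸ resolve ψ .parts × α ∈ Δ
      part∈ {ψ} ψ∈Δ = by-contradiction λ none →
        avoids (resolve ψ .elim (hyp ψ∈Δ) λ α∈ →
          by-contradiction λ ¬e → none (_ , α∈ , maximal ¬e))

      canonical-⊨ : ψ ∈ Δ → canonicalTeam ⊨ ψ
      canonical-⊨ {ψ} ψ∈Δ with part∈ ψ∈Δ
      ... | α , α∈ , α∈Δ =
        sound {Γ = ｛ α ｝} (resolve ψ .intro α∈ (hyp refl)) canonicalTeam
          λ { refl → flat-⊨ (resolve ψ .flat α∈) λ s∈X → s∈X (resolve ψ .flat α∈) α∈Δ }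

      canonical-⊭ : Not (canonicalTeam ⊨ θ)
      canonical-⊭ x with resolve θ .cover x
      ... | β , β∈ , b = avoids (resolve θ .intro β∈
        (flat-complete (resolve θ .flat β∈) λ s s∈X → pointwise β b s∈X))

    complete : Γ ⊩ φ → Γ ⊢ˢ φ
    complete {Γ} {φ} Γ⊩φ = by-contradiction λ ¬d →
      let Δ , Γ⊆Δ , max = lindenbaum Γ φ ¬d
      in canonical-⊭ max (Γ⊩φ (canonicalTeam max) (canonical-⊨ max ∘ Γ⊆Δ))

-- Natural deduction

module Natural {L : Logic} .⦃ _ : HasTensor L ⦄ where

  private variable
    Γ Δ : Theory L
    φ ψ χ θ α : Formula L

  open Calculus (_⊢ᴺ_ {L}) limᴺ

  here! : (Γ ∪ ｛ φ ｝) ⊢ᴺ φ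
  here! = hyp (inj₂ refl)

  ⊥⊗E : Γ ⊢ᴺ ⊥ ⊗ φ → Γ ⊢ᴺ φ
  ⊥⊗E d = ⊥E (⊗comm d)

  -- Without implication, substitution under a tensor does the work: `φ` becomes `⊥ ⊗ φ`, then
  -- `⊥ ⊗ ψ`, and the `⊥` is dropped.
  cut : Γ ⊢ᴺ φ → (Γ ∪ ｛ φ ｝) ⊢ᴺ ψ → Γ ⊢ᴺ ψ
  cut d e = ⊥⊗E (⊗sub (⊗I₂ d) e)

  ⊥-elimᴺ : Γ ⊢ᴺ ⊥ → Γ ⊢ᴺ φ
  ⊥-elimᴺ d = ⊥E (⊗I₂ d)

  contradictionᴺ : Γ ⊢ᴺ p i → Γ ⊢ᴺ ¬p i → Γ ⊢ᴺ φ
  contradictionᴺ d e = ⊥-elimᴺ (⊥I (∧I d e))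

  -- Contexts, read from the hole outwards.

  data Frame : Set where
    □∧_ ∧□_ □⊗_ ⊗□_ : Formula L → Frame

  Context : Set
  Context = List Frame

  plug : Frame → Formula L → Formula L
  plug (□∧ ψ) φ = φ ∧ ψ
  plug (∧□ ψ) φ = ψ ∧ φ
  plug (□⊗ ψ) φ = φ ⊗ ψ
  plug (⊗□ ψ) φ = ψ ⊗ φ

  _[_] : Context → Formula L → Formula L
  []      [ φ ] = φ
  (F ∷ C) [ φ ] = C [ plug F φ ]

  plug-mono : ∀ F → (∀ {Δ} → Δ ⊢ᴺ φ → Δ ⊢ᴺ ψ) → Γ ⊢ᴺ plug F φ → Γ ⊢ᴺ plug F ψ
  plug-mono (□∧ χ) f d = ∧I (f (∧E₁ d)) (∧E₂ d)
  plug-mono (∧□ χ) f d = ∧I (∧E₁ d) (f (∧E₂ d))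
  plug-mono (□⊗ χ) f d = ⊗comm (⊗sub (⊗comm d) (f here!))
  plug-mono (⊗□ χ) f d = ⊗sub d (f here!)

  mono : ∀ C → (∀ {Δ} → Δ ⊢ᴺ φ → Δ ⊢ᴺ ψ) → Γ ⊢ᴺ C [ φ ] → Γ ⊢ᴺ C [ ψ ]
  mono []      f = f
  mono (F ∷ C) f = mono C (plug-mono F f)

  module _ .⦃ _ : HasOr L ⦄ where

    plug-∨ : ∀ F → Γ ⊢ᴺ plug F (φ ∨ ψ) → Γ ⊢ᴺ plug F φ ∨ plug F ψ
    plug-∨ (□∧ χ) d = ∨E (∧E₁ d)
      (∨I₁ (∧I here! (wk (∧E₂ d)))) (∨I₂ (∧I here! (wk (∧E₂ d))))
    plug-∨ (∧□ χ) d = ∨E (∧E₂ d)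
      (∨I₁ (∧I (wk (∧E₁ d)) here!)) (∨I₂ (∧I (wk (∧E₁ d)) here!))
    plug-∨ (□⊗ χ) d = ∨E (distr (⊗comm d)) (∨I₁ (⊗comm here!)) (∨I₂ (⊗comm here!))
    plug-∨ (⊗□ χ) d = distr d

    context-∨ : ∀ C → Γ ⊢ᴺ C [ φ ∨ ψ ] → Γ ⊢ᴺ C [ φ ] ∨ C [ ψ ]
    context-∨ []      d = d
    context-∨ (F ∷ C) d = context-∨ C (mono C (plug-∨ F) d)

  module _ .⦃ _ : HasDep L ⦄ where

    plug-occurrence : ∀ F → Occurrence i φ → Occurrence i (plug F φ)
    plug-occurrence (□∧ ψ) = ∧ˡ
    plug-occurrence (∧□ ψ) = ∧ʳ
    plug-occurrence (□⊗ ψ) = ⊗ˡ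
    plug-occurrence (⊗□ ψ) = ⊗ʳ

    replace-plug : ∀ F (o : Occurrence i φ) →
                   replace (plug-occurrence F o) χ ≡ plug F (replace o χ)
    replace-plug (□∧ ψ) o = refl
    replace-plug (∧□ ψ) o = refl
    replace-plug (□⊗ ψ) o = refl
    replace-plug (⊗□ ψ) o = refl

    occurrence : ∀ C → Occurrence i φ → Occurrence i (C [ φ ])
    occurrence []      o = o
    occurrence (F ∷ C) o = occurrence C (plug-occurrence F o)

    replace-occurrence : ∀ C (o : Occurrence i φ) →
                         replace (occurrence C o) χ ≡ C [ replace o χ ]
    replace-occurrence []      o = refl
    replace-occurrence (F ∷ C) o =
      trans (replace-occurrence C (plug-occurrence F o)) (cong (C [_]) (replace-plug F o))

    -- The counterpart in `PD` of `context-∨`: strong elimination at the occurrence sitting in the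
    -- hole.
    context-con : ∀ C → Γ ⊢ᴺ C [ con i ] →
                  (Γ ∪ ｛ C [ p i ] ｝) ⊢ᴺ θ → (Γ ∪ ｛ C [ ¬p i ] ｝) ⊢ᴺ θ → Γ ⊢ᴺ θ
    context-con {Γ = Γ} {θ = θ} C d e f = strE (occurrence C here) d
      (subst (λ χ → (Γ ∪ ｛ χ ｝) ⊢ᴺ θ) (sym (replace-occurrence C here)) e)
      (subst (λ χ → (Γ ∪ ｛ χ ｝) ⊢ᴺ θ) (sym (replace-occurrence C here)) f)

    -- =(p_i, p_is, p_j) lets p_j depend on p_is alone once p_i is fixed.
    dep-split : Γ ⊢ᴺ dep (i ∷ is) j → Γ ⊢ᴺ (p i ∧ dep is j) ⊗ (¬p i ∧ dep is j)
    dep-split {i = i} {is = is} {j = j} d =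
      ⊗sub (⊗comm (⊗sub (⊗comm (em i)) (∧I here! (part conI₁ (wk d) here!))))
           (∧I here! (part conI₀ (wk d) here!))
      where
      part : (∀ {Δ} → Δ ⊢ᴺ φ → Δ ⊢ᴺ con i) → Γ ⊢ᴺ dep (i ∷ is) j → Γ ⊢ᴺ φ → Γ ⊢ᴺ dep is j
      part c d e = depI (depE (wk d) λ
        { (here refl) → c (wk e) ; (there k∈is) → hyp (inj₂ (∈-map⁺ _ k∈is)) })

    -- Among the assumptions that `depI` discharges is `con i`, which splits into the two cases.
    depI-∷ : (Γ ∪ ｛ p i ｝) ⊢ᴺ dep is j → (Γ ∪ ｛ ¬p i ｝) ⊢ᴺ dep is j → Γ ⊢ᴺ dep (i ∷ is) j
    depI-∷ d e = depI (conE (hyp (inj₂ (here refl))) (branch d) (branch e))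
      where
      branch : (Γ ∪ ｛ φ ｝) ⊢ᴺ dep is j →
               ((Γ ∪ (_∈ᴸ List.map (λ k → con k) (i ∷ is))) ∪ ｛ φ ｝) ⊢ᴺ con j
      branch d = depE (wk₂ d) λ k∈is →
        hyp (inj₁ (inj₂ (there (∈-map⁺ _ k∈is))))

  -- Resolution into classical formulas

  tensor : Formula L → Formula L → Formula L
  tensor φ ψ = φ ⊗ ψ

  -- Each part is the decision tree of one Boolean function giving the value of `j` from those of
  -- `is`, so there are `2^(2^k)` parts for `k` arguments.
  depParts : List ℕ → ℕ → List (Formula L)
  depParts []       j = p j ∷ ¬p j ∷ []
  depParts (i ∷ is) j =
    cartesianProductWith (λ α β → (p i ∧ α) ⊗ (¬p i ∧ β)) (depParts is j) (depParts is j)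

  parts : Formula L → List (Formula L)
  parts (p i)      = p i ∷ []
  parts ⊥          = ⊥ ∷ []
  parts (¬p i)     = ¬p i ∷ []
  parts (dep is j) = depParts is j
  parts (φ ∧ ψ)    = cartesianProductWith _∧_ (parts φ) (parts ψ)
  parts (φ ⊗ ψ)    = cartesianProductWith tensor (parts φ) (parts ψ)
  parts (φ ∨ ψ)    = parts φ ++ parts ψ
  parts (_⇒_ ⦃ h ⦄ φ ψ) = ⊥-elim (tensor-no-imp L it h)

  depParts-classical : ∀ is → α ∈ᴸ depParts is j → Classical α
  depParts-classical []       (here refl)         = p _
  depParts-classical []       (there (here refl)) = ¬p _
  depParts-classical (i ∷ is) α∈
    with _ , _ , β∈ , γ∈ , refl ←
      ∈-cartesianProductWith⁻ _ (depParts is _) (depParts is _) α∈ =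
    (p i ∧ depParts-classical is β∈) ⊗ (¬p i ∧ depParts-classical is γ∈)

  parts-classical : ∀ φ → α ∈ᴸ parts φ → Classical α
  parts-classical (p i)      (here refl) = p i
  parts-classical ⊥          (here refl) = ⊥
  parts-classical (¬p i)     (here refl) = ¬p i
  parts-classical (dep is j) α∈ = depParts-classical is α∈
  parts-classical (φ ∧ ψ)    α∈
    with _ , _ , β∈ , γ∈ , refl ← ∈-cartesianProductWith⁻ _∧_ (parts φ) (parts ψ) α∈ =
    parts-classical φ β∈ ∧ parts-classical ψ γ∈
  parts-classical (φ ⊗ ψ)    α∈
    with _ , _ , β∈ , γ∈ , refl ← ∈-cartesianProductWith⁻ tensor (parts φ) (parts ψ) α∈ =
    parts-classical φ β∈ ⊗ parts-classical ψ γ∈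
  parts-classical (φ ∨ ψ)    α∈ with ∈-++⁻ (parts φ) α∈
  ... | inj₁ β∈ = parts-classical φ β∈
  ... | inj₂ γ∈ = parts-classical ψ γ∈
  parts-classical (_⇒_ ⦃ h ⦄ φ ψ) = ⊥-elim (tensor-no-imp L it h)

  depParts-intro : .⦃ _ : HasDep L ⦄ → ∀ is → α ∈ᴸ depParts is j → Γ ⊢ᴺ α → Γ ⊢ᴺ dep is j
  depParts-intro []       (here refl)         d = conI₁ d
  depParts-intro []       (there (here refl)) d = conI₀ d
  depParts-intro (i ∷ is) α∈ d
    with _ , _ , β∈ , γ∈ , refl ←
      ∈-cartesianProductWith⁻ _ (depParts is _) (depParts is _) α∈ =
    depI-∷
      -- Under `p i` the right half of the tensor is contradictory and can be discarded; under
      -- `¬p i` the left half is.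
      (depParts-intro is β∈
        (∧E₂ (⊥E (⊗sub (wk d) (contradictionᴺ (wk here!) (∧E₁ here!))))))
      (depParts-intro is γ∈
        (∧E₂ (⊥E (⊗sub (⊗comm (wk d)) (contradictionᴺ (∧E₁ here!) (wk here!))))))

  parts-intro : ∀ φ → α ∈ᴸ parts φ → Γ ⊢ᴺ α → Γ ⊢ᴺ φ
  parts-intro (p i)      (here refl) d = d
  parts-intro ⊥          (here refl) d = d
  parts-intro (¬p i)     (here refl) d = d
  parts-intro (dep is j) α∈ d = depParts-intro is α∈ d
  parts-intro (φ ∧ ψ)    α∈ d
    with _ , _ , β∈ , γ∈ , refl ← ∈-cartesianProductWith⁻ _∧_ (parts φ) (parts ψ) α∈ =
    ∧I (parts-intro φ β∈ (∧E₁ d)) (parts-intro ψ γ∈ (∧E₂ d))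
  parts-intro (φ ⊗ ψ)    α∈ d
    with _ , _ , β∈ , γ∈ , refl ← ∈-cartesianProductWith⁻ tensor (parts φ) (parts ψ) α∈ =
    plug-mono (□⊗ ψ) (parts-intro φ β∈) (plug-mono (⊗□ _) (parts-intro ψ γ∈) d)
  parts-intro (φ ∨ ψ)    α∈ d with ∈-++⁻ (parts φ) α∈
  ... | inj₁ β∈ = ∨I₁ (parts-intro φ β∈ d)
  ... | inj₂ γ∈ = ∨I₂ (parts-intro ψ γ∈ d)
  parts-intro (_⇒_ ⦃ h ⦄ φ ψ) = ⊥-elim (tensor-no-imp L it h)

  -- Once `dep-split` is applied in place, the two smaller atoms are resolved in turn, each in the
  -- context enlarged by its sibling.
  depParts-elim : .⦃ _ : HasDep L ⦄ → ∀ is C → Γ ⊢ᴺ C [ dep is j ] →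
                  (∀ {α} → α ∈ᴸ depParts is j → (Γ ∪ ｛ C [ α ] ｝) ⊢ᴺ θ) → Γ ⊢ᴺ θ
  depParts-elim []       C d f = context-con C d (f (here refl)) (f (there (here refl)))
  depParts-elim (i ∷ is) C d f =
    depParts-elim is ((∧□ p i) ∷ (□⊗ _) ∷ C) (mono C dep-split d) λ α∈ →
    depParts-elim is ((∧□ ¬p i) ∷ (⊗□ _) ∷ C) here! λ β∈ →
    wk₂ (f (∈-cartesianProductWith⁺ _ α∈ β∈))

  -- The induction needs an arbitrary context: weak elimination cannot take a tensor apart towards a
  -- nonclassical `θ`, so its two sides are resolved inside it.
  parts-elim : ∀ φ C → Γ ⊢ᴺ C [ φ ] →
               (∀ {α} → α ∈ᴸ parts φ → (Γ ∪ ｛ C [ α ] ｝) ⊢ᴺ θ) → Γ ⊢ᴺ θ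
  parts-elim (p i)      C d f = cut d (f (here refl))
  parts-elim ⊥          C d f = cut d (f (here refl))
  parts-elim (¬p i)     C d f = cut d (f (here refl))
  parts-elim (dep is j) C d f = depParts-elim is C d f
  parts-elim (φ ∧ ψ)    C d f =
    parts-elim φ ((□∧ ψ) ∷ C) d λ α∈ →
    parts-elim ψ ((∧□ _) ∷ C) here! λ β∈ →
    wk₂ (f (∈-cartesianProductWith⁺ _∧_ α∈ β∈))
  parts-elim (φ ⊗ ψ)    C d f =
    parts-elim φ ((□⊗ ψ) ∷ C) d λ α∈ →
    parts-elim ψ ((⊗□ _) ∷ C) here! λ β∈ →
    wk₂ (f (∈-cartesianProductWith⁺ tensor α∈ β∈))
  parts-elim (φ ∨ ψ)    C d f = ∨E (context-∨ C d)
    (parts-elim φ C here! λ α∈ → wk₂ (f (∈-++⁺ˡ α∈)))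
    (parts-elim ψ C here! λ β∈ → wk₂ (f (∈-++⁺ʳ (parts φ) β∈)))
  parts-elim (_⇒_ ⦃ h ⦄ φ ψ) = ⊥-elim (tensor-no-imp L it h)

  module Cover (lem : ExcludedMiddle 1ℓ) where
    open Semantics lem

    depParts-cover : .⦃ _ : HasDep L ⦄ → ∀ is → X ⊨ (Formula L ∋ dep is j) →
                     ∃ λ α → α ∈ᴸ depParts is j × X ⊨ α
    depParts-cover []       x with con-⊨⁻ {L} x
    ... | inj₁ t = _ , here refl , lift t
    ... | inj₂ f = _ , there (here refl) , lift f
    depParts-cover {X = X} (i ∷ is) x
      -- Soundness of the derived splitting supplies the two subteams.
      with soundᴺ {Γ = ｛ dep (i ∷ is) _ ｝} (dep-split (hyp refl)) X (λ { refl → x })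
    ... | A , B , eq , (a , a′) , (b , b′)
      with depParts-cover is a′ | depParts-cover is b′
    ... | α , α∈ , y | β , β∈ , z =
      _ , ∈-cartesianProductWith⁺ _ α∈ β∈ , A , B , eq , (a , y) , (b , z)

    parts-cover : ∀ φ → X ⊨ φ → ∃ λ α → α ∈ᴸ parts φ × X ⊨ α
    parts-cover (p i)      x = _ , here refl , x
    parts-cover ⊥          x = _ , here refl , x
    parts-cover (¬p i)     x = _ , here refl , x
    parts-cover (dep is j) x = depParts-cover is x
    parts-cover (φ ∧ ψ) (x , y) with parts-cover φ x | parts-cover ψ y
    ... | α , α∈ , x′ | β , β∈ , y′ =
      _ , ∈-cartesianProductWith⁺ _∧_ α∈ β∈ , x′ , y′
    parts-cover (φ ⊗ ψ) (A , B , eq , x , y) with parts-cover φ x | parts-cover ψ y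
    ... | α , α∈ , x′ | β , β∈ , y′ =
      _ , ∈-cartesianProductWith⁺ tensor α∈ β∈ , A , B , eq , x′ , y′
    parts-cover (φ ∨ ψ) (inj₁ x) with parts-cover φ x
    ... | α , α∈ , x′ = α , ∈-++⁺ˡ α∈ , x′
    parts-cover (φ ∨ ψ) (inj₂ y) with parts-cover ψ y
    ... | β , β∈ , y′ = β , ∈-++⁺ʳ (parts φ) β∈ , y′
    parts-cover (_⇒_ ⦃ h ⦄ φ ψ) = ⊥-elim (tensor-no-imp L it h)

    resolveᴺ : ∀ φ → Resolution Classical φ
    resolveᴺ φ = record
      { parts = parts φ
      ; flat  = parts-classical φ
      ; intro = parts-intro φ
      ; elim  = parts-elim φ []
      ; cover = parts-cover φ
      }

    -- Completeness for classical formulas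

    module _ {θ : Formula L} (cθ : Classical θ) (max : MaximalAvoiding θ Δ) where
      open MaximalAvoiding max

      closed : Δ ⊢ᴺ φ → φ ∈ Δ
      closed d = maximal (avoids ∘ cut d)

      -- Here the avoided formula has to be classical: weak elimination would otherwise not reach
      -- `θ`.
      prime : Δ ⊢ᴺ φ ⊗ ψ → φ ∈ Δ ⊎ ψ ∈ Δ
      prime {φ} {ψ} d with dec (φ ∈ Δ)
      ... | yes φ∈ = inj₁ φ∈
      ... | no  φ∉ = inj₂ (maximal λ e →
        φ∉ (maximal λ e′ → avoids (⊗E cθ d e′ e)))

      canonicalᴺ : Valuation
      canonicalᴺ i = does (dec (p i ∈ Δ))

      holds⇒derivable : Classical α → Holds canonicalᴺ α → Δ ⊢ᴺ α
      holds⇒derivable (p i) h with dec (p i ∈ Δ)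
      ... | yes x = hyp x
      holds⇒derivable (¬p i) h with dec (p i ∈ Δ)
      ... | no  x = hyp ([ ⊥-elim ∘ x , id ] (prime (em i)))
      holds⇒derivable (c ∧ d) (x , y) = ∧I (holds⇒derivable c x) (holds⇒derivable d y)
      holds⇒derivable (c ⊗ d) (inj₁ x) = ⊗I₁ (holds⇒derivable c x)
      holds⇒derivable (c ⊗ d) (inj₂ y) = ⊗I₂ (holds⇒derivable d y)

      derivable⇒holds : Classical α → Δ ⊢ᴺ α → Holds canonicalᴺ α
      derivable⇒holds (p i) x with dec (p i ∈ Δ)
      ... | yes _ = refl
      ... | no  y = ⊥-elim (y (closed x))
      derivable⇒holds (¬p i) x with dec (p i ∈ Δ)
      ... | yes y = ⊥-elim (avoids (contradictionᴺ (hyp y) x))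
      ... | no  _ = refl
      derivable⇒holds ⊥ x = avoids (⊥-elimᴺ x)
      derivable⇒holds (c ∧ d) x = derivable⇒holds c (∧E₁ x) , derivable⇒holds d (∧E₂ x)
      derivable⇒holds (c ⊗ d) x =
        Sum.map (derivable⇒holds c ∘ hyp) (derivable⇒holds d ∘ hyp) (prime x)

    -- If `β` is not derivable, extend `Δ` to a maximal theory avoiding it. The canonical valuation
    -- satisfies the classical members of `Δ`, hence `β`, which makes `β` derivable from the
    -- extension after all.
    classical-complete : ∀ {β} → Classical β →
      (∀ s → (∀ {α} → Classical α → α ∈ Δ → Holds s α) → Holds s β) → Δ ⊢ᴺ β
    classical-complete {Δ} {β} c h = by-contradiction λ ¬d →
      let Δ′ , Δ⊆Δ′ , max = lindenbaum Δ β ¬d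
      in MaximalAvoiding.avoids max (holds⇒derivable c max c
           (h (canonicalᴺ c max) λ cα α∈Δ → derivable⇒holds c max cα (hyp (Δ⊆Δ′ α∈Δ))))

    theoremᴺ : (Γ ⊢ᴺ φ) ⇔ (Γ ⊩ φ)
    theoremᴺ = mk⇔ soundᴺ complete
      where open Completeness lem hyp soundᴺ
                   Classical classical-⊨ classical-complete resolveᴺ

-- Hilbert calculus

module Hilbert where

  open Calculus _⊢ᴴ_ limᴴ

  private variable
    Γ Δ : Theory PID
    φ ψ χ θ α : Formula PID

  here! : (Γ ∪ ｛ φ ｝) ⊢ᴴ φ
  here! = hyp (inj₂ refl)

  deduction : (Γ ∪ ｛ φ ｝) ⊢ᴴ ψ → Γ ⊢ᴴ φ ⇒ ψ
  deduction (hyp (inj₁ ψ∈Γ)) = mp (ax (K _ _)) (hyp ψ∈Γ)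
  deduction (hyp (inj₂ refl)) = mp (mp (ax (S _ _ _)) (ax (K _ _))) (ax (K _ ⊥))
  deduction (ax a)   = mp (ax (K _ _)) (ax a)
  deduction (mp d e) = mp (mp (ax (S _ _ _)) (deduction d)) (deduction e)

  cut : Γ ⊢ᴴ φ → (Γ ∪ ｛ φ ｝) ⊢ᴴ ψ → Γ ⊢ᴴ ψ
  cut d e = mp (deduction e) d

  ∧-intro : Γ ⊢ᴴ φ → Γ ⊢ᴴ ψ → Γ ⊢ᴴ φ ∧ ψ
  ∧-intro d e = mp (mp (ax (∧I _ _)) d) e

  ∧-elim₁ : Γ ⊢ᴴ φ ∧ ψ → Γ ⊢ᴴ φ
  ∧-elim₁ d = mp (ax (∧E₁ _ _)) d

  ∧-elim₂ : Γ ⊢ᴴ φ ∧ ψ → Γ ⊢ᴴ ψ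
  ∧-elim₂ d = mp (ax (∧E₂ _ _)) d

  ∨-intro₁ : Γ ⊢ᴴ φ → Γ ⊢ᴴ φ ∨ ψ
  ∨-intro₁ d = mp (ax (∨I₁ _ _)) d

  ∨-intro₂ : Γ ⊢ᴴ ψ → Γ ⊢ᴴ φ ∨ ψ
  ∨-intro₂ d = mp (ax (∨I₂ _ _)) d

  ∨-elim : Γ ⊢ᴴ φ ∨ ψ → (Γ ∪ ｛ φ ｝) ⊢ᴴ θ → (Γ ∪ ｛ ψ ｝) ⊢ᴴ θ → Γ ⊢ᴴ θ
  ∨-elim d e f = mp (mp (mp (ax (∨E _ _ _)) (deduction e)) (deduction f)) d

  ⊥-elimᴴ : Γ ⊢ᴴ ⊥ → Γ ⊢ᴴ φ
  ⊥-elimᴴ d = mp (ax (⊥E _)) d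

  double-negation : Γ ⊢ᴴ φ → Γ ⊢ᴴ ¬ (¬ φ)
  double-negation d = deduction (mp here! (wk d))

  ⋀-intro : ∀ x xs → (∀ {y} → y ∈ᴸ x ∷ xs → Γ ⊢ᴴ y) → Γ ⊢ᴴ ⋀ (x ∷ xs)
  ⋀-intro x []       f = f (here refl)
  ⋀-intro x (y ∷ ys) f = ∧-intro (f (here refl)) (⋀-intro y ys (f ∘ there))

  ⋀-elim : ∀ x xs → φ ∈ᴸ x ∷ xs → Γ ⊢ᴴ ⋀ (x ∷ xs) → Γ ⊢ᴴ φ
  ⋀-elim x []       (here refl) d = d
  ⋀-elim x (y ∷ ys) (here refl) d = ∧-elim₁ d
  ⋀-elim x (y ∷ ys) (there z∈)  d = ⋀-elim y ys z∈ (∧-elim₂ d)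

  ⋁-intro : ∀ x xs → φ ∈ᴸ x ∷ xs → Γ ⊢ᴴ φ → Γ ⊢ᴴ ⋁ (x ∷ xs)
  ⋁-intro x []       (here refl) d = d
  ⋁-intro x (y ∷ ys) (here refl) d = ∨-intro₁ d
  ⋁-intro x (y ∷ ys) (there z∈)  d = ∨-intro₂ (⋁-intro y ys z∈ d)

  ⋁-elim : ∀ x xs → Γ ⊢ᴴ ⋁ (x ∷ xs) → (∀ {y} → y ∈ᴸ x ∷ xs → (Γ ∪ ｛ y ｝) ⊢ᴴ θ) → Γ ⊢ᴴ θ
  ⋁-elim x []       d f = cut d (f (here refl))
  ⋁-elim x (y ∷ ys) d f = ∨-elim d (f (here refl))
    (⋁-elim y ys here! λ z∈ → wk₂ (f (there z∈)))

  -- φ is equivalent to the disjunction of the negations of the formulas in negands.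
  record NormalForm (φ : Formula PID) : Set₁ where
    field
      negands : List⁺ (Formula PID)
      intro   : χ ∈ᴸ List⁺.toList negands → Γ ⊢ᴴ ¬ χ → Γ ⊢ᴴ φ
      elim    : Γ ⊢ᴴ φ → (∀ {χ} → χ ∈ᴸ List⁺.toList negands → (Γ ∪ ｛ ¬ χ ｝) ⊢ᴴ θ) → Γ ⊢ᴴ θ
  open NormalForm

  nf-equivalent : (∀ {Γ} → Γ ⊢ᴴ φ → Γ ⊢ᴴ ψ) → (∀ {Γ} → Γ ⊢ᴴ ψ → Γ ⊢ᴴ φ) →
                  NormalForm φ → NormalForm ψ
  nf-equivalent f g n = record
    { negands = n .negands
    ; intro   = λ χ∈ d → f (n .intro χ∈ d)
    ; elim    = λ d e → n .elim (g d) e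
    }

  nf-¬ : ∀ χ → NormalForm (¬ χ)
  nf-¬ χ = record
    { negands = χ ∷ []
    ; intro   = λ { (here refl) d → d }
    ; elim    = λ d e → cut d (e (here refl))
    }

  nf-∨ : NormalForm φ → NormalForm ψ → NormalForm (φ ∨ ψ)
  nf-∨ {φ} {ψ} m n = record
    { negands = m .negands List⁺.⁺++⁺ n .negands
    ; intro   = λ χ∈ d →
        [ (λ χ∈ → ∨-intro₁ (m .intro χ∈ d)) , (λ χ∈ → ∨-intro₂ (n .intro χ∈ d)) ]
          (∈-++⁻ (List⁺.toList (m .negands)) χ∈)
    ; elim    = λ d e → ∨-elim d
        (m .elim here! λ χ∈ → wk₂ (e (∈-++⁺ˡ χ∈)))
        (n .elim here! λ χ∈ → wk₂ (e (∈-++⁺ʳ (List⁺.toList (m .negands)) χ∈)))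
    }

  -- ¬ χ ∧ ¬ χ′ is equivalent to ¬ (χ ∨ χ′).
  nf-∧ : NormalForm φ → NormalForm ψ → NormalForm (φ ∧ ψ)
  nf-∧ {φ} {ψ} m n with m .negands | m .intro | m .elim | n .negands | n .intro | n .elim
  ... | x ∷ xs | introₘ | elimₘ | y ∷ ys | introₙ | elimₙ = record
    { negands = (x ∨ y) ∷ (List.map (x ∨_) ys ++ cartesianProductWith _∨_ xs (y ∷ ys))
    ; intro   = λ χ∈ d → pair-intro (∈-cartesianProductWith⁻ _∨_ (x ∷ xs) (y ∷ ys) χ∈) d
    ; elim    = λ d e →
        elimₘ (∧-elim₁ d) λ a∈ → elimₙ (wk (∧-elim₂ d)) λ b∈ →
        cut (deduction (∨-elim here! (mp (wk (wk (wk here!))) here!)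
                                     (mp (wk (wk here!)) here!)))
            (weaken (Sum.map₁ (inj₁ ∘ inj₁)) (e (∈-cartesianProductWith⁺ _∨_ a∈ b∈)))
    }
    where
    pair-intro : (∃₂ λ a b → a ∈ᴸ x ∷ xs × b ∈ᴸ y ∷ ys × χ ≡ (a ∨ b)) →
                 Γ ⊢ᴴ ¬ χ → Γ ⊢ᴴ φ ∧ ψ
    pair-intro (a , b , a∈ , b∈ , refl) d = ∧-intro
      (introₘ a∈ (deduction (mp (wk d) (∨-intro₁ here!))))
      (introₙ b∈ (deduction (mp (wk d) (∨-intro₂ here!))))

  nf-⋀ : ∀ x xs → (∀ {y} → y ∈ᴸ x ∷ xs → NormalForm y) → NormalForm (⋀ (x ∷ xs))
  nf-⋀ x []       f = f (here refl)
  nf-⋀ x (y ∷ ys) f = nf-∧ (f (here refl)) (nf-⋀ y ys (f ∘ there))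

  -- By the disjunction axiom; ¬ χ ⇒ ¬ χ′ is equivalent to ¬ (¬ χ ∧ χ′).
  nf-¬⇒ : ∀ χ → NormalForm ψ → NormalForm (¬ χ ⇒ ψ)
  nf-¬⇒ {ψ} χ n with n .negands | n .intro | n .elim
  ... | y ∷ ys | introₙ | elimₙ = record
    { negands = List⁺.map (¬ χ ∧_) (y ∷ ys)
    ; intro   = λ χ∈ d → single-intro (∈-map⁻ _ χ∈) d
    ; elim    = λ d e → ⋁-elim (¬ χ ⇒ ¬ y) (List.map (λ z → ¬ χ ⇒ ¬ z) ys)
        (mp (ax (disj χ (y ∷ ys)))
            (deduction (elimₙ (mp (wk d) here!) λ z∈ →
               ⋁-intro (¬ y) (List.map ¬_ ys) (∈-map⁺ ¬_ z∈) here!)))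
        λ z∈ → single-elim e (∈-map⁻ (λ z → ¬ χ ⇒ ¬ z) {xs = y ∷ ys} z∈)
    }
    where
    single-intro : (∃ λ z → z ∈ᴸ y ∷ ys × φ ≡ (¬ χ ∧ z)) → Γ ⊢ᴴ ¬ φ → Γ ⊢ᴴ ¬ χ ⇒ ψ
    single-intro (z , z∈ , refl) d =
      deduction (introₙ z∈ (deduction (mp (wk (wk d)) (∧-intro (wk here!) here!))))

    single-elim : (∀ {φ} → φ ∈ᴸ List.map (¬ χ ∧_) (y ∷ ys) → (Γ ∪ ｛ ¬ φ ｝) ⊢ᴴ θ) →
                  (∃ λ z → z ∈ᴸ y ∷ ys × φ ≡ (¬ χ ⇒ ¬ z)) → (Γ ∪ ｛ φ ｝) ⊢ᴴ θ
    single-elim e (z , z∈ , refl) =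
      cut (deduction (mp (mp (wk here!) (∧-elim₁ here!)) (∧-elim₂ here!)))
          (wk₂ (e (∈-map⁺ (¬ χ ∧_) z∈)))

  -- An implication from a disjunction of negations is a conjunction of implications `¬ z ⇒ ψ`, and
  -- each of these is handled by `nf-¬⇒`.
  nf-⇒ : NormalForm φ → NormalForm ψ → NormalForm (φ ⇒ ψ)
  nf-⇒ {φ} {ψ} m n with m .negands | m .intro | m .elim
  ... | x ∷ xs | introₘ | elimₘ = nf-equivalent
    (λ d → deduction (elimₘ here! λ z∈ →
       mp (⋀-elim _ _ (∈-map⁺ (λ z → ¬ z ⇒ ψ) z∈) (wk (wk d))) here!))
    (λ d → ⋀-intro _ _ λ y∈ → forward d (∈-map⁻ (λ z → ¬ z ⇒ ψ) {xs = x ∷ xs} y∈))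
    (nf-⋀ (¬ x ⇒ ψ) (List.map (λ z → ¬ z ⇒ ψ) xs)
       λ y∈ → component (∈-map⁻ (λ z → ¬ z ⇒ ψ) {xs = x ∷ xs} y∈))
    where
    forward : Γ ⊢ᴴ φ ⇒ ψ → (∃ λ z → z ∈ᴸ x ∷ xs × χ ≡ (¬ z ⇒ ψ)) → Γ ⊢ᴴ χ
    forward d (z , z∈ , refl) = deduction (mp (wk d) (introₘ z∈ here!))

    component : (∃ λ z → z ∈ᴸ x ∷ xs × χ ≡ (¬ z ⇒ ψ)) → NormalForm χ
    component (z , _ , refl) = nf-¬⇒ z n

  nf-p : ∀ i → NormalForm (p i)
  nf-p i = nf-equivalent (λ d → mp (ax (dne i)) d) double-negation (nf-¬ (¬ p i))

  nf-con : ∀ i → NormalForm (con i)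
  nf-con i = nf-equivalent
    (λ d → mp (∧-elim₂ (ax (conA i))) d) (λ d → mp (∧-elim₁ (ax (conA i))) d)
    (nf-∨ (nf-p i) (nf-¬ (p i)))

  nf : ∀ φ → NormalForm φ
  nf (p i)   = nf-p i
  nf ⊥       = nf-equivalent (λ d → mp d (deduction here!)) ⊥-elimᴴ (nf-¬ (⊥ ⇒ ⊥))
  nf (dep [] j) = nf-con j
  nf (dep (i ∷ is) j) = nf-equivalent
    (λ d → mp (∧-elim₂ (ax (depA i is j))) d) (λ d → mp (∧-elim₁ (ax (depA i is j))) d)
    (nf-⇒ (nf-⋀ (con i) (List.map (λ k → con k) is)
             λ y∈ → component (∈-map⁻ (λ k → con k) {xs = i ∷ is} y∈))
          (nf-con j))
    where
    component : (∃ λ k → k ∈ᴸ i ∷ is × χ ≡ con k) → NormalForm χ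
    component (k , _ , refl) = nf-con k
  nf (φ ∧ ψ) = nf-∧ (nf φ) (nf ψ)
  nf (φ ∨ ψ) = nf-∨ (nf φ) (nf ψ)
  nf (φ ⇒ ψ) = nf-⇒ (nf φ) (nf ψ)

  module Complete (lem : ExcludedMiddle 1ℓ) where
    open Semantics lem

    ⋁-⊨⁻ : ∀ x xs → X ⊨ ⋁ (x ∷ xs) → ∃ λ y → y ∈ᴸ x ∷ xs × X ⊨ y
    ⋁-⊨⁻ x []       d = x , here refl , d
    ⋁-⊨⁻ x (y ∷ ys) (inj₁ d) = x , here refl , d
    ⋁-⊨⁻ x (y ∷ ys) (inj₂ d) with ⋁-⊨⁻ y ys d
    ... | z , z∈ , e = z , there z∈ , e

    resolveᴴ : ∀ φ → Resolution Negated φ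
    resolveᴴ φ with nf φ
    ... | n with n .negands | n .intro | n .elim
    ... | x ∷ xs | introₙ | elimₙ = record
      { parts = List.map ¬_ (x ∷ xs)
      ; flat  = λ α∈ → flat (∈-map⁻ ¬_ {xs = x ∷ xs} α∈)
      ; intro = λ α∈ → part-intro (∈-map⁻ ¬_ {xs = x ∷ xs} α∈)
      ; elim  = λ d e → elimₙ d λ χ∈ → e (∈-map⁺ ¬_ χ∈)
      -- The disjunction of the parts is a formula of `PID`, so soundness of its derivation from `φ`
      -- already selects a part.
      ; cover = λ {X} x⊨ → ⋁-⊨⁻ (¬ x) (List.map ¬_ xs)
          (soundᴴ {Γ = ｛ φ ｝} (elimₙ (hyp refl) λ χ∈ → ⋁-intro _ _ (∈-map⁺ ¬_ χ∈) here!) X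
             λ { refl → x⊨ })
      }
      where
      flat : (∃ λ z → z ∈ᴸ x ∷ xs × α ≡ ¬ z) → Negated α
      flat (z , _ , refl) = neg z

      part-intro : (∃ λ z → z ∈ᴸ x ∷ xs × α ≡ ¬ z) → Γ ⊢ᴴ α → Γ ⊢ᴴ φ
      part-intro (z , z∈ , refl) = introₙ z∈

    negated-⊨ : Negated α → (∀ {s} → s ∈ X → Holds s α) → X ⊨ α
    negated-⊨ (neg χ) = negation-⊨ χ

    -- Completeness for negations

    module _ (max : MaximalAvoiding ⊥ Δ) where
      open MaximalAvoiding max

      closed : Δ ⊢ᴴ φ → φ ∈ Δ
      closed d = maximal (avoids ∘ cut d)

      refutable : Not (φ ∈ Δ) → Δ ⊢ᴴ ¬ φ
      refutable φ∉ = deduction (by-contradiction (φ∉ ∘ maximal))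

      prime : Δ ⊢ᴴ φ ∨ ψ → φ ∈ Δ ⊎ ψ ∈ Δ
      prime {φ} {ψ} d with dec (φ ∈ Δ)
      ... | yes φ∈ = inj₁ φ∈
      ... | no  φ∉ = inj₂ (maximal λ e → φ∉ (maximal λ e′ → avoids (∨-elim d e′ e)))

      canonicalᴴ : Valuation
      canonicalᴴ i = does (dec (p i ∈ Δ))

      -- A maximal consistent theory decides every variable. This agrees with `Holds`, for which
      -- dependence atoms are trivial.
      con∈ : ∀ i → con i ∈ Δ
      con∈ i with dec (p i ∈ Δ)
      ... | yes x = closed (mp (∧-elim₂ (ax (conA i))) (∨-intro₁ (hyp x)))
      ... | no  x = closed (mp (∧-elim₂ (ax (conA i))) (∨-intro₂ (refutable x)))

      ∈⇒holds : ∀ φ → φ ∈ Δ → Holds canonicalᴴ φ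
      holds⇒∈ : ∀ φ → Holds canonicalᴴ φ → φ ∈ Δ

      ∈⇒holds (p i) x with dec (p i ∈ Δ)
      ... | yes _ = refl
      ... | no  y = ⊥-elim (y x)
      ∈⇒holds ⊥          x = avoids (hyp x)
      ∈⇒holds (dep is j) x = tt
      ∈⇒holds (φ ∧ ψ)    x =
        ∈⇒holds φ (closed (∧-elim₁ (hyp x))) , ∈⇒holds ψ (closed (∧-elim₂ (hyp x)))
      ∈⇒holds (φ ∨ ψ)    x = Sum.map (∈⇒holds φ) (∈⇒holds ψ) (prime (hyp x))
      ∈⇒holds (φ ⇒ ψ)    x h = ∈⇒holds ψ (closed (mp (hyp x) (hyp (holds⇒∈ φ h))))

      holds⇒∈ (p i) h with dec (p i ∈ Δ)
      ... | yes x = x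
      holds⇒∈ (dep [] j)       h = con∈ j
      holds⇒∈ (dep (i ∷ is) j) h =
        closed (mp (∧-elim₂ (ax (depA i is j))) (deduction (wk (hyp (con∈ j)))))
      holds⇒∈ (φ ∧ ψ) (x , y)  = closed (∧-intro (hyp (holds⇒∈ φ x)) (hyp (holds⇒∈ ψ y)))
      holds⇒∈ (φ ∨ ψ) (inj₁ x) = closed (∨-intro₁ (hyp (holds⇒∈ φ x)))
      holds⇒∈ (φ ∨ ψ) (inj₂ y) = closed (∨-intro₂ (hyp (holds⇒∈ ψ y)))
      holds⇒∈ (φ ⇒ ψ) h with dec (φ ∈ Δ)
      ... | yes x = closed (deduction (wk (hyp (holds⇒∈ ψ (h (∈⇒holds φ x))))))
      ... | no  x = closed (deduction (⊥-elimᴴ (mp (wk (refutable x)) here!)))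

    -- If `¬ χ` is not derivable, then adding `χ` is consistent, and the valuation of a maximal
    -- extension satisfies both `Δ` and `χ`.
    negated-complete : ∀ {β} → Negated β →
      (∀ s → (∀ {α} → Negated α → α ∈ Δ → Holds s α) → Holds s β) → Δ ⊢ᴴ β
    negated-complete {Δ} (neg χ) h = by-contradiction λ ¬d →
      let Δ′ , Δ⊆Δ′ , max = lindenbaum (Δ ∪ ｛ χ ｝) ⊥ (¬d ∘ deduction)
      in h (canonicalᴴ max) (λ { {α} _ α∈Δ → ∈⇒holds max α (Δ⊆Δ′ (inj₁ α∈Δ)) })
           (∈⇒holds max χ (Δ⊆Δ′ (inj₂ refl)))

    theoremᴴ : (Γ ⊢ᴴ φ) ⇔ (Γ ⊩ φ)
    theoremᴴ = mk⇔ soundᴴ complete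
      where open Completeness lem hyp soundᴴ
                   Negated negated-⊨ negated-complete resolveᴴ

theorem1p8 : ExcludedMiddle 1ℓ →
    (L : Logic) (Γ : Theory L) (φ : Formula L) → (Γ ⊢ φ) ⇔ (Γ ⊩ φ)
theorem1p8 lem PD  Γ φ = Natural.Cover.theoremᴺ lem
theorem1p8 lem PD∨ Γ φ = Natural.Cover.theoremᴺ lem
theorem1p8 lem PID Γ φ = Hilbert.Complete.theoremᴴ lem
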